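{- For all integers $n\geq 0$, $c_{2}(5n+2)\equiv 0 \pmod 2$.
   Context: A partition of $n$ is a finite non-increasing sequence of positive integers (its parts) summing to $n$. Let $c_{2}(n)$ be the number of pairs $(j,\lambda)$ where $j\geq 1$ is an integer and $\lambda$ is a partition of $n$ such that: each of the odd integers $1,3,\ldots,2j-1$ appears in $\lambda$ exactly once; every even part of $\lambda$ is greater than $2j$, and the even parts are distinct; and odd parts $\geq 2j+1$ may appear with any multiplicity. Equivalently, $\sum_{n\ge0}c_2(n)q^n=\sum_{j\ge1} q^{j^2}\prod_{i\ge 1}(1+q^{2j+2i})\prod_{i\ge0}(1-q^{2j+1+2i})^{ -1}$. -}

module Defs where

open import Data.Bool using (Bool; true; false; _∧_; _∨_; not; if_then_else_)
open import Data.Nat using (ℕ; zero; suc; _+_; _*_; _∸_; _≡ᵇ_; _<ᵇ_; _≤ᵇ_; _%_)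
open import Data.List using (List; []; _∷_; [_]; map; concatMap; filterᵇ; applyUpTo; length; cartesianProduct)
open import Data.Product using (_×_; _,_)
open import Data.Nat.ListAction using (sum)

occ : ℕ → List ℕ → ℕ
occ k []       = 0
occ k (x ∷ xs) = (if k ≡ᵇ x then 1 else 0) + occ k xs

allᵇ : {A : Set} → (A → Bool) → List A → Bool
allᵇ p []       = true
allᵇ p (x ∷ xs) = p x ∧ allᵇ p xs

nonIncreasingᵇ : List ℕ → Bool
nonIncreasingᵇ []           = true
nonIncreasingᵇ (x ∷ [])     = true
nonIncreasingᵇ (x ∷ y ∷ xs) = (y ≤ᵇ x) ∧ nonIncreasingᵇ (y ∷ xs)

isPartitionᵇ : ℕ → List ℕ → Bool
isPartitionᵇ n λs = nonIncreasingᵇ λs ∧ allᵇ (λ p → 0 <ᵇ p) λs ∧ (sum λs ≡ᵇ n)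

evenᵇ : ℕ → Bool
evenᵇ p = p % 2 ≡ᵇ 0

goodᵇ : ℕ → List ℕ → Bool
goodᵇ j λs =
  (0 <ᵇ j)
  ∧ allᵇ (λ i → occ (2 * i + 1) λs ≡ᵇ 1) (applyUpTo (λ i → i) j)
  ∧ allᵇ (λ p → not (evenᵇ p) ∨ ((2 * j <ᵇ p) ∧ (occ p λs ≡ᵇ 1))) λs

-- candidate lists: all partitions of n with parts ≤ m (fuel-driven enumeration,
-- fuel = n suffices as each step removes a positive part)
partsBounded : ℕ → ℕ → ℕ → List (List ℕ)
partsBounded _        zero    m = [ [] ]
partsBounded zero     (suc n) m = []
partsBounded (suc f)  (suc n) m =
  concatMap (λ k → map (k ∷_) (partsBounded f (suc n ∸ k) k))
            (filterᵇ (λ k → k ≤ᵇ m) (applyUpTo suc (suc n)))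

partitions : ℕ → List (List ℕ)
partitions n = partsBounded n n n

-- c₂ n = number of pairs (j, λ) with λ a partition of n satisfying the conditions.
-- j ranges over 1..n: for j > n no pair exists, since 1+3+…+(2j-1) = j² > n.
c₂ : ℕ → ℕ
c₂ n = length (filterᵇ (λ { (j , λs) → isPartitionᵇ n λs ∧ goodᵇ j λs })
                       (cartesianProduct (applyUpTo suc n) (partitions n)))

{-# OPTIONS --safe #-}

-- Modulo 2 the generating function of c₂ is Σ_{j≥1} q^{j²} ψ / P_j, where
-- P_n = Π_{i=1}^{n} (1+q^{2i})/(1+q^{2i-1}) and ψ = P_∞, and we show that it equals
--   Σ_{k∈ℤ} q^{4k²+k} + Σ_{k≥0} q^{k(k+1)/2},
-- none of whose exponents is 2 mod 5.  The second sum is ψ (Gauss), obtained from Shanks's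
-- finite identity.  For the first, put f_a = Σ_{j≥0} q^{j²+2aj} / P_j.  Then
--   f_a = (1 + q^{2a+1}) f_{a+1} + q^{2a+2} f_{a+2},
-- and by a telescoping certificate the deformation r_a of Σ_k q^{4k²+k} that the Bailey lemma
-- suggests satisfies the same recurrence.  Since ψ f_a and r_a both tend to ψ as a → ∞, they
-- agree for all a; take a = 0.

module Submission where

open import Defs
open import Algebra.Bundles using (CommutativeRing; CommutativeSemiring; RawRing)
import Algebra.Properties.CommutativeSemigroup
import Algebra.Properties.CommutativeSemiring.Exp
import Algebra.Solver.Ring
open import Algebra.Solver.Ring.AlmostCommutativeRing using
    (fromCommutativeSemiring; _-Raw-AlmostCommutative⟶_)
open import Algebra.Structures.Biased using (isCommutativeSemiringˡ)
open import Data.Bool using (Bool; true; false; _∧_; _∨_; not; _xor_; if_then_else_; T)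
open import Data.Bool.Properties using
    (T?; T-∧; T-≡; not-involutive; xor-assoc; xor-comm; xor-identityʳ; xor-∧-commutativeRing; ∧-assoc;
    ∧-comm; ∧-distribˡ-xor; ∧-distribʳ-xor)
open import Data.List using (List; []; _∷_; [_]; _++_; applyUpTo; cartesianProduct; concat; concatMap;
    filterᵇ; length; map)
import Data.List.Properties as Listₚ
open import Data.List.Membership.Propositional using (_∈_)
open import Data.List.Relation.Unary.All as All using (All; []; _∷_)
import Data.List.Relation.Unary.All.Properties as Allₚ
open import Data.List.Relation.Unary.Any using (here; there)
open import Data.Maybe using (Maybe; just; nothing)
open import Data.Nat using (ℕ; zero; suc; _∸_; _%_; _<_; _≡ᵇ_; _≤ᵇ_; _<ᵇ_; z≤n; s≤s) renaming
    (_+_ to _+ℕ_; _*_ to _*ℕ_; _≤_ to _≤ℕ_)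
open import Data.Nat.Divisibility using (_∣_; divides)
open import Data.Nat.DivMod using ([m+kn]%n≡m%n)
open import Data.Nat.ListAction using (sum)
import Data.Nat.Properties as ℕₚ
open import Data.Nat.Solver using (module +-*-Solver)
open import Data.Product using (∃; _×_; _,_; proj₁; proj₂; uncurry)
open import Data.Sum using (_⊎_; inj₁; inj₂)
open import Data.Unit using (tt)
open import Function using (_∘_; id)
open import Function.Bundles using (Equivalence)
open import Level using (0ℓ)
open import Relation.Binary.PropositionalEquality as ≡ using (_≡_; _≢_; cong; cong₂)
import Relation.Binary.Reasoning.Setoid
open import Relation.Binary.Structures using (IsEquivalence)
open import Relation.Nullary using (contradiction)

-- The parameter a is there for uniqueness: the recurrence expresses the value at a through those at
-- a + 1 and a + 2, so a solution is determined by its values at all large a. In the truncated ring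
-- "large" means a > degree, where every term but the leading one vanishes, and a downward induction
-- takes the place of the limit. The obstacle is that 1 + Q^0 = 0, with Q = q². The summands contain
-- the inverse of 1 + Q^n, so the telescoping in n can only start at n = 1; the term n = 0, which is
-- P a, is matched separately against the lower boundary term of the telescoped sum. The sum over
-- triangular numbers arises because ψ f_0 has a term j = 0, equal to ψ, which the sum over j ≥ 1
-- lacks. The residue 2 modulo 5 is avoided because 16(4k² + k) + 1 = (8k + 1)² and 8 k(k+1)/2 + 1 =
-- (2k + 1)²: an exponent congruent to 2 would make the non-residues 3 and 2 squares modulo 5.

open Algebra.Properties.CommutativeSemigroup (CommutativeRing.+-commutativeSemigroup xor-∧-commutativeRing)
  using (interchange; x∙yz≈y∙xz)

-- The quotient 𝔽₂[[q]]/(q^{degree+1}), abstractly: since q is nilpotent, infinite sums and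
-- products are finite ones, and no limits are needed.
record TruncatedSeries : Set₁ where
  field
    commutativeSemiring : CommutativeSemiring 0ℓ 0ℓ
  open CommutativeSemiring commutativeSemiring public
  open Algebra.Properties.CommutativeSemiring.Exp commutativeSemiring public
  field
    1+1≈0 : 1# + 1# ≈ 0#
    q : Carrier
    degree : ℕ
    q^[1+degree]≈0 : q ^ suc degree ≈ 0#

-- Two successors per step, so that passing from the bound `double i` to `double (suc i)` is
-- definitionally one odd part followed by one even part.
double : ℕ → ℕ
double zero    = zero
double (suc i) = suc (suc (double i))

-- θ n = 4n² − n and τ m = m(2m + 1).
θ : ℕ → ℕ
θ zero    = 0
θ (suc n) = θ n +ℕ (((n +ℕ n) +ℕ (n +ℕ n)) +ℕ ((n +ℕ n) +ℕ (n +ℕ n))) +ℕ 3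

τ : ℕ → ℕ
τ m = m +ℕ (m *ℕ m +ℕ m *ℕ m)

module QSeries (𝓢 : TruncatedSeries) where
  open TruncatedSeries 𝓢
  open Relation.Binary.Reasoning.Setoid setoid

  -- Coefficients for the ring solver: with `xor` as addition its normal forms cancel equal terms,
  -- so it proves identities of characteristic 2 directly.
  𝔽₂ : RawRing 0ℓ 0ℓ
  𝔽₂ = record { Carrier = Bool ; _≈_ = _≡_ ; _+_ = _xor_ ; _*_ = _∧_ ; -_ = id ; 0# = false ; 1# = true }

  fromBool : Bool → Carrier
  fromBool true  = 1#
  fromBool false = 0#

  fromBool-morphism : 𝔽₂ -Raw-AlmostCommutative⟶ fromCommutativeSemiring commutativeSemiring
  fromBool-morphism = record
    { ⟦_⟧    = fromBool
    ; +-homo = λ { true true → sym 1+1≈0 ; true false → sym (+-identityʳ 1#) ; false y → sym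
        (+-identityˡ _) }
    ; *-homo = λ { true y → sym (*-identityˡ _) ; false y → sym (zeroˡ _) }
    ; -‿homo = λ _ → refl
    ; 0-homo = refl
    ; 1-homo = refl
    }

  fromBool-≈? : ∀ b c → Maybe (fromBool b ≈ fromBool c)
  fromBool-≈? true  true  = just refl
  fromBool-≈? false false = just refl
  fromBool-≈? true  false = nothing
  fromBool-≈? false true  = nothing

  open Algebra.Solver.Ring 𝔽₂ (fromCommutativeSemiring commutativeSemiring) fromBool-morphism fromBool-≈?
    using (solve; _:=_; _:+_; _:*_; con)

  -- Characteristic 2, finite sums and geometric series

  x+x≈0 : ∀ x → x + x ≈ 0#
  x+x≈0 = solve 1 (λ x → x :+ x := con false) refl

  x+y≈0⇒x≈y : ∀ {x y} → x + y ≈ 0# → x ≈ y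
  x+y≈0⇒x≈y {x} {y} h = begin
    x           ≈⟨ solve 2 (λ x y → x := (x :+ y) :+ y) refl x y ⟩
    (x + y) + y ≈⟨ +-congʳ h ⟩
    0# + y      ≈⟨ +-identityˡ y ⟩
    y           ∎

  -- This replaces division. The solver sees inverses as free variables, so terms are brought over a
  -- common denominator by inserting factors `u * i`, after which a polynomial identity remains.
  insert-unit : ∀ {z u i} → u * i ≈ 1# → z ≈ z * (u * i)
  insert-unit {z} h = trans (sym (*-identityʳ z)) (*-congˡ (sym h))

  order : ℕ
  order = suc degree

  Σ : ℕ → (ℕ → Carrier) → Carrier
  Σ zero    f = 0#
  Σ (suc n) f = Σ n f + f n

  Σ-cong : ∀ {f g} n → (∀ i → f i ≈ g i) → Σ n f ≈ Σ n g
  Σ-cong zero    h = refl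
  Σ-cong (suc n) h = +-cong (Σ-cong n h) (h n)

  Σ-+ : ∀ n f g → Σ n (λ i → f i + g i) ≈ Σ n f + Σ n g
  Σ-+ zero    f g = sym (+-identityˡ _)
  Σ-+ (suc n) f g = trans (+-congʳ (Σ-+ n f g))
    (solve 4 (λ a b c d → (a :+ b) :+ (c :+ d) := (a :+ c) :+ (b :+ d)) refl _ _ _ _)

  Σ-* : ∀ n c f → Σ n (λ i → c * f i) ≈ c * Σ n f
  Σ-* zero    c f = sym (zeroʳ c)
  Σ-* (suc n) c f = trans (+-congʳ (Σ-* n c f)) (sym (distribˡ c _ _))

  Σ-shift : ∀ n f → Σ (suc n) f ≈ f 0 + Σ n (f ∘ suc)
  Σ-shift zero    f = +-comm _ _
  Σ-shift (suc n) f = trans (+-congʳ (Σ-shift n f)) (+-assoc _ _ _)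

  Σ-zero : ∀ n {f} → (∀ i → f i ≈ 0#) → Σ n f ≈ 0#
  Σ-zero zero    h = refl
  Σ-zero (suc n) h = trans (+-cong (Σ-zero n h) (h n)) (+-identityˡ _)

  Σ-telescope : ∀ n (g : ℕ → Carrier) → Σ n (λ i → g i + g (suc i)) ≈ g 0 + g n
  Σ-telescope zero    g = sym (x+x≈0 _)
  Σ-telescope (suc n) g = trans (+-congʳ (Σ-telescope n g))
    (solve 3 (λ a b c → (a :+ b) :+ (b :+ c) := a :+ c) refl _ _ _)

  q^n≈0 : ∀ {n} → order ≤ℕ n → q ^ n ≈ 0#
  q^n≈0 {n} h = begin
    q ^ n                          ≈⟨ ^-congʳ q (≡.sym (ℕₚ.m+[n∸m]≡n h)) ⟩
    q ^ (order +ℕ (n ∸ order))     ≈⟨ ^-homo-* q order (n ∸ order) ⟩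
    q ^ order * q ^ (n ∸ order)    ≈⟨ *-congʳ q^[1+degree]≈0 ⟩
    0# * q ^ (n ∸ order)           ≈⟨ zeroˡ _ ⟩
    0#                             ∎

  geo : Carrier → Carrier
  geo w = Σ order (w ^_)

  -- The product telescopes to 1 + (q v)^order, whose last power vanishes because q is nilpotent;
  -- hence the argument has to be a visible multiple of q.
  geo-inverse : ∀ v → (1# + q * v) * geo (q * v) ≈ 1#
  geo-inverse v = begin
    (1# + q * v) * geo (q * v)                     ≈⟨ Σ-* order _ _ ⟨
    Σ order (λ i → (1# + q * v) * (q * v) ^ i)
      ≈⟨ Σ-cong order (λ i → solve 2 (λ w z → (con true :+ w) :* z := z :+ w :* z) refl _ _) ⟩
    Σ order (λ i → (q * v) ^ i + (q * v) ^ suc i)  ≈⟨ Σ-telescope order ((q * v) ^_) ⟩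
    1# + (q * v) ^ order                           ≈⟨ +-congˡ (^-distrib-* q v order) ⟩
    1# + q ^ order * v ^ order                     ≈⟨ +-congˡ (trans (*-congʳ q^[1+degree]≈0) (zeroˡ _)) ⟩
    1# + 0#                                        ≈⟨ +-identityʳ 1# ⟩
    1#                                             ∎

  Q : Carrier
  Q = q * q

  Q^ : ℕ → Carrier
  Q^ n = Q ^ n

  Q^-+ : ∀ m n → Q^ (m +ℕ n) ≈ Q^ m * Q^ n
  Q^-+ = ^-homo-* Q

  -- even⁻¹ 0 is junk, because 1 + Q⁰ = 0.
  odd even odd⁻¹ even⁻¹ : ℕ → Carrier
  odd n    = 1# + q * Q^ n
  even n   = 1# + Q^ n
  odd⁻¹ n  = geo (q * Q^ n)
  even⁻¹ n = geo (Q^ n)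

  odd-inverse : ∀ n → odd n * odd⁻¹ n ≈ 1#
  odd-inverse n = geo-inverse (Q^ n)

  geo-cong : ∀ {w z} → w ≈ z → geo w ≈ geo z
  geo-cong h = Σ-cong order (λ i → ^-congˡ i h)

  even-inverse : ∀ n → even (suc n) * even⁻¹ (suc n) ≈ 1#
  even-inverse n = trans (*-cong (+-congˡ (*-assoc _ _ _)) (geo-cong (*-assoc _ _ _))) (geo-inverse _)

  P P⁻¹ : ℕ → Carrier
  P zero      = 1#
  P (suc n)   = P n * (even (suc n) * odd⁻¹ n)
  P⁻¹ zero    = 1#
  P⁻¹ (suc n) = P⁻¹ n * (odd n * even⁻¹ (suc n))

  P-inverse : ∀ n → P n * P⁻¹ n ≈ 1#
  P-inverse zero    = *-identityˡ 1#
  P-inverse (suc n) = begin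
    P (suc n) * P⁻¹ (suc n)
      ≈⟨ solve 6 (λ a b e o e′ o′ → (a :* (e :* o′)) :* (b :* (o :* e′))
           := (a :* b) :* (e :* e′) :* (o :* o′)) refl (P n) (P⁻¹ n) (even (suc n)) (odd n) (even⁻¹ (suc n))
           (odd⁻¹ n) ⟩
    (P n * P⁻¹ n) * (even (suc n) * even⁻¹ (suc n)) * (odd n * odd⁻¹ n)
      ≈⟨ *-cong (*-cong (P-inverse n) (even-inverse n)) (odd-inverse n) ⟩
    1# * 1# * 1#
      ≈⟨ solve 0 (con true :* con true :* con true := con true) refl ⟩
    1# ∎

  E : ℕ → ℕ → Carrier
  E a n = Q^ (a *ℕ n)

  E-sucˡ : ∀ a n → E (suc a) n ≈ Q^ n * E a n
  E-sucˡ a n = Q^-+ n (a *ℕ n)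

  E-sucʳ : ∀ a n → E a (suc n) ≈ Q^ a * E a n
  E-sucʳ a n = trans (^-congʳ Q (ℕₚ.*-suc a n)) (Q^-+ a (a *ℕ n))

  -- The product F(n) ... F(n+a-1). For `even` and `odd⁻¹` it is the shifted factorial (Q^n;Q)_a and
  -- the inverse of (q Q^n;Q)_a, signs being immaterial modulo 2.
  Π : (ℕ → Carrier) → ℕ → ℕ → Carrier
  Π F n zero    = 1#
  Π F n (suc a) = Π F n a * F (n +ℕ a)

  Π-shift : ∀ F n a → Π F (suc n) a * F n ≈ Π F n a * F (n +ℕ a)
  Π-shift F n zero    = *-congˡ (reflexive (≡.cong F (≡.sym (ℕₚ.+-identityʳ n))))
  Π-shift F n (suc a) = begin
    Π F (suc n) a * F (suc n +ℕ a) * F n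
      ≈⟨ solve 3 (λ a b c → a :* b :* c := a :* c :* b) refl _ _ _ ⟩
    Π F (suc n) a * F n * F (suc n +ℕ a)
      ≈⟨ *-cong (Π-shift F n a) (reflexive (≡.cong F (≡.sym (ℕₚ.+-suc n a)))) ⟩
    Π F n a * F (n +ℕ a) * F (n +ℕ suc a)         ∎

  -- The identity behind s-telescopes, at x = q^{2a} and y = q^{2n}, where t is the n-th summand
  -- and i₀, i₁, i₂ stand for the inverses of the factors in the hypotheses.
  certificate : ∀ t i₀ i₁ i₂ q x y → let Q = q * q in
    (1# + y) * i₀ ≈ 1# → (1# + q * (y * x)) * i₁ ≈ 1# → (1# + q * (y * (Q * x))) * i₂ ≈ 1# →
    t * i₀ * (1# + y * y * x)
    + (1# + q * x) * (t * (y * y * (1# + y * x) * i₁) * i₀ * (1# + y * y * (Q * x)))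
    + Q * x * (t * (y * y * (1# + y * x) * i₁) * (y * y * (1# + y * (Q * x)) * i₂) * i₀ *
        (1# + y * y * (Q * (Q * x))))
    ≈ t * (1# + (1# + q * x) * y + x * y * y) * i₁
    + t * (y * y * y * y * Q * q * x * x * ((1# + y * x) * i₀) * ((1# + q * y) * i₁)) *
        (1# + (1# + q * x) * (Q * y) + x * (Q * y) * (Q * y)) * i₂
  certificate t i₀ i₁ i₂ q x y h₀ h₁ h₂ = begin
    -- Everything is put over the common denominator of `i₀`, `i₁`, `i₂`; what remains holds as a
    -- polynomial identity with these three as free variables.
    _ ≈⟨ +-congʳ (+-cong (trans (insert-unit h₁) (insert-unit h₂)) (*-congˡ (insert-unit h₂))) ⟩
    _ ≈⟨ solve 7 (λ t i₀ i₁ i₂ q x y → let Q = q :* q ; 1′ = con true in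
             t :* i₀ :* (1′ :+ y :* y :* x) :* ((1′ :+ q :* (y :* x)) :* i₁) :*
                 ((1′ :+ q :* (y :* (Q :* x))) :* i₂)
             :+ (1′ :+ q :* x) :* (t :* (y :* y :* (1′ :+ y :* x) :* i₁) :* i₀ :* (1′ :+ y :* y :* (Q :* x))
                 :* ((1′ :+ q :* (y :* (Q :* x))) :* i₂))
             :+ Q :* x :* (t :* (y :* y :* (1′ :+ y :* x) :* i₁) :* (y :* y :* (1′ :+ y :* (Q :* x)) :* i₂)
                 :* i₀ :* (1′ :+ y :* y :* (Q :* (Q :* x))))
             := t :* (1′ :+ (1′ :+ q :* x) :* y :+ x :* y :* y) :* i₁ :* ((1′ :+ y) :* i₀) :*
                 ((1′ :+ q :* (y :* (Q :* x))) :* i₂)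
             :+ t :* (y :* y :* y :* y :* Q :* q :* x :* x :* ((1′ :+ y :* x) :* i₀) :*
                 ((1′ :+ q :* y) :* i₁)) :* (1′ :+ (1′ :+ q :* x) :* (Q :* y) :+ x :* (Q :* y) :* (Q :* y))
                 :* i₂)
           refl t i₀ i₁ i₂ q x y ⟩
    _ ≈⟨ +-congʳ (trans (insert-unit h₀) (insert-unit h₂)) ⟨
    _ ∎

  annihilates : ∀ {z} x → z ≈ 0# → x * z ≈ 0#
  annihilates x h = trans (*-congˡ h) (zeroʳ x)

  annihilatesˡ : ∀ {z} x → z ≈ 0# → z * x ≈ 0#
  annihilatesˡ x h = trans (*-congʳ h) (zeroˡ x)

  Q^n≈0 : ∀ {n} → order ≤ℕ n → Q^ n ≈ 0#
  Q^n≈0 {n} h = trans (^-distrib-* q q n) (annihilates _ (q^n≈0 h))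

  E≈0 : ∀ {a} n → order ≤ℕ a → E a (suc n) ≈ 0#
  E≈0 {a} n h = trans (E-sucʳ a n) (annihilatesˡ _ (Q^n≈0 h))

  -- Both new factors are 1 modulo q^{degree+1}, so `P degree` can stand for the infinite product ψ.
  P-stable-suc : ∀ n → degree ≤ℕ n → P (suc n) ≈ P n
  P-stable-suc n h = trans (*-congˡ (begin
      even (suc n) * odd⁻¹ n  ≈⟨ *-cong (trans (+-congˡ (Q^n≈0 (s≤s h))) (+-identityʳ 1#)) odd⁻¹≈1 ⟩
      1# * 1#                 ≈⟨ *-identityˡ 1# ⟩
      1#                      ∎)) (*-identityʳ _)
    where
    odd≈1 : odd n ≈ 1#
    odd≈1 = trans (+-congˡ (trans (*-congˡ (^-distrib-* q q n))
        (trans (sym (*-assoc _ _ _)) (annihilatesˡ _ (q^n≈0 (s≤s h)))))) (+-identityʳ 1#)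
    odd⁻¹≈1 : odd⁻¹ n ≈ 1#
    odd⁻¹≈1 = trans (sym (*-identityˡ _)) (trans (*-congʳ (sym odd≈1)) (odd-inverse n))

  P-stable : ∀ k → P (k +ℕ degree) ≈ P degree
  P-stable zero    = refl
  P-stable (suc k) = trans (P-stable-suc (k +ℕ degree) (ℕₚ.m≤n+m degree k)) (P-stable k)

  -- The series `f a` and its recurrence

  f-term : ℕ → ℕ → Carrier
  f-term a j = P⁻¹ j * q ^ (j *ℕ j) * E a j

  f : ℕ → Carrier
  f a = Σ order (f-term a)

  q^suc² : ∀ j → q ^ (suc j *ℕ suc j) ≈ q ^ (j *ℕ j) * (q * Q^ j)
  q^suc² j = begin
    q ^ (suc j *ℕ suc j)                 ≈⟨ *-congˡ (^-homo-* q j (j *ℕ suc j)) ⟩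
    q * (q ^ j * q ^ (j *ℕ suc j))
      ≈⟨ *-congˡ (*-congˡ (trans (^-congʳ q (ℕₚ.*-suc j j)) (^-homo-* q j (j *ℕ j)))) ⟩
    q * (q ^ j * (q ^ j * q ^ (j *ℕ j)))
      ≈⟨ solve 3 (λ q z w → q :* (z :* (z :* w)) := w :* (q :* (z :* z))) refl _ _ _ ⟩
    q ^ (j *ℕ j) * (q * (q ^ j * q ^ j)) ≈⟨ *-congˡ (*-congˡ (^-distrib-* q q j)) ⟨
    q ^ (j *ℕ j) * (q * Q^ j)            ∎

  -- In f_a + f_{a+1} the j-th term gains the factor 1 + Q^j. It kills j = 0 and cancels the last
  -- denominator of `P⁻¹ j` otherwise; after the shift j → j + 1 the remaining numerator 1 + q Q^j
  -- splits each term into one of f_{a+1} and one of f_{a+2}. The term that the shift pushes past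
  -- the summation range carries q^{order²} and vanishes.
  f-recurrence : ∀ a → f a ≈ (1# + q * Q^ a) * f (suc a) + Q * Q^ a * f (suc (suc a))
  f-recurrence a = x+y≈0⇒x≈y (begin
      f a + ((1# + q * Q^ a) * f (suc a) + Q * Q^ a * f (suc (suc a)))
        ≈⟨ solve 5 (λ f f′ f″ u v → f :+ ((con true :+ u) :* f′ :+ v :* f″)
             := (f :+ f′) :+ (u :* f′ :+ v :* f″)) refl _ _ _ _ _ ⟩
      (f a + f (suc a)) + (q * Q^ a * f (suc a) + Q * Q^ a * f (suc (suc a)))
        ≈⟨ +-cong (sym (Σ-+ order _ _))
            (sym (trans (Σ-+ order _ _) (+-cong (Σ-* order _ _) (Σ-* order _ _)))) ⟩
      Σ order h + Σ order (λ j → q * Q^ a * f-term (suc a) j + Q * Q^ a * f-term (suc (suc a)) j)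
        ≈⟨ +-cong sum-h (Σ-cong order (λ j → sym (h-suc j))) ⟩
      Σ order (h ∘ suc) + Σ order (h ∘ suc)
        ≈⟨ x+x≈0 _ ⟩
      0# ∎)
    where
    h : ℕ → Carrier
    h j = f-term a j + f-term (suc a) j
    h-factor : ∀ j → h j ≈ P⁻¹ j * q ^ (j *ℕ j) * E a j * even j
    h-factor j = trans (+-congˡ (*-congˡ (E-sucˡ a j)))
      (solve 3 (λ b e y → b :* e :+ b :* (y :* e) := b :* e :* (con true :+ y)) refl _ _ _)
    h-zero : h 0 ≈ 0#
    h-zero = trans (h-factor 0) (annihilates _ 1+1≈0)
    h-last : h order ≈ 0#
    h-last = trans (h-factor order)
        (annihilatesˡ _ (annihilatesˡ _ (annihilates _ (q^n≈0 (ℕₚ.m≤m+n order _)))))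
    h-suc : ∀ j → h (suc j) ≈ q * Q^ a * f-term (suc a) j + Q * Q^ a * f-term (suc (suc a)) j
    h-suc j = begin
      h (suc j)
        ≈⟨ h-factor (suc j) ⟩
      P⁻¹ j * (odd j * even⁻¹ (suc j)) * q ^ (suc j *ℕ suc j) * E a (suc j) * even (suc j)
        ≈⟨ *-congʳ (*-cong (*-congˡ (q^suc² j)) (E-sucʳ a j)) ⟩
      P⁻¹ j * (odd j * even⁻¹ (suc j)) * (q ^ (j *ℕ j) * (q * Q^ j)) * (Q^ a * E a j) * even (suc j)
        ≈⟨ solve 8 (λ p o i s t x e u → p :* (o :* i) :* (s :* t) :* (x :* e) :* u
             := p :* o :* (s :* t) :* (x :* e) :* (u :* i)) refl _ _ _ _ _ _ _ _ ⟩
      P⁻¹ j * odd j * (q ^ (j *ℕ j) * (q * Q^ j)) * (Q^ a * E a j) * (even (suc j) * even⁻¹ (suc j))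
        ≈⟨ insert-unit (even-inverse j) ⟨
      P⁻¹ j * odd j * (q ^ (j *ℕ j) * (q * Q^ j)) * (Q^ a * E a j)
        ≈⟨ solve 6 (λ p q s y x e → p :* (con true :+ q :* y) :* (s :* (q :* y)) :* (x :* e)
             := q :* x :* (p :* s :* (y :* e)) :+ q :* q :* x :* (p :* s :* (y :* (y :* e)))) refl (P⁻¹ j) q
                 (q ^ (j *ℕ j)) (Q^ j) (Q^ a) (E a j) ⟩
      q * Q^ a * (P⁻¹ j * q ^ (j *ℕ j) * (Q^ j * E a j)) + Q * Q^ a *
          (P⁻¹ j * q ^ (j *ℕ j) * (Q^ j * (Q^ j * E a j)))
        ≈⟨ +-cong (*-congˡ (*-congˡ (E-sucˡ a j)))
            (*-congˡ (*-congˡ (trans (E-sucˡ (suc a) j) (*-congˡ (E-sucˡ a j))))) ⟨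
      q * Q^ a * f-term (suc a) j + Q * Q^ a * f-term (suc (suc a)) j ∎
    sum-h : Σ order h ≈ Σ order (h ∘ suc)
    sum-h = begin
      Σ order h                ≈⟨ +-identityʳ _ ⟨
      Σ order h + 0#           ≈⟨ +-congˡ h-last ⟨
      Σ (suc order) h          ≈⟨ Σ-shift order h ⟩
      h 0 + Σ order (h ∘ suc)  ≈⟨ +-congʳ h-zero ⟩
      0# + Σ order (h ∘ suc)   ≈⟨ +-identityˡ _ ⟩
      Σ order (h ∘ suc)        ∎

  f-limit : ∀ a → order ≤ℕ a → f a ≈ 1#
  f-limit a h = begin
    f a                                          ≈⟨ Σ-shift degree (f-term a) ⟩
    f-term a 0 + Σ degree (f-term a ∘ suc)
      ≈⟨ +-cong (*-congˡ (^-congʳ Q (ℕₚ.*-zeroʳ a))) (Σ-zero degree (λ j → annihilates _ (E≈0 j h))) ⟩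
    1# * 1# * 1# + 0#
      ≈⟨ solve 0 (con true :* con true :* con true :+ con false := con true) refl ⟩
    1#                                           ∎

  -- The deformed theta sum `r a` and its telescoping

  -- r a = P a + Σ_{n≥1} s-term a n is the sum
  --   Σ_n q^{4n²−n} x^{2n} (1 − x y²) (x;Q)_n (q;Q)_n / ((1 − x) (Q;Q)_n (q x;Q)_n),  Q = q², x = Q^a, y = Q^n,
  -- over 𝔽₂ times a factor depending on a only, rewritten so that its denominators remain
  -- invertible at x = 1.  The term n = 0 is P a.
  Θ : ℕ → Carrier
  Θ zero    = 1#
  Θ (suc n) = Θ n * (Q^ n * Q^ n * Q^ n * Q^ n * Q * q)

  -- The roles of a and n in the shifted factorials are exchanged. For a, n ≥ 1, (x;Q)_n / ((1 -
  -- x)(Q;Q)_n) = (Q^n;Q)_a / ((1 - Q^n)(Q;Q)_a), and (q;Q)_n / (qx;Q)_n = (q;Q)_a / (q Q^n;Q)_a.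
  -- Multiplying the sum by P a clears (q;Q)_a / (Q;Q)_a, and the factor 1 - x disappears from the
  -- denominators.
  summand : ℕ → ℕ → Carrier
  summand a n = Θ n * (E a n * E a n) * Π even n a * Π odd⁻¹ n a

  summand-sucˡ : ∀ a n → summand (suc a) n ≈ summand a n *
      (Q^ n * Q^ n * (1# + Q^ n * Q^ a) * odd⁻¹ (n +ℕ a))
  summand-sucˡ a n = trans (*-congʳ
      (*-cong (*-congˡ (*-cong (E-sucˡ a n) (E-sucˡ a n))) (*-congˡ (+-congˡ (Q^-+ n a)))))
    (solve 7 (λ t y e p u d i → t :* (y :* e :* (y :* e)) :* (p :* u) :* (d :* i)
         := t :* (e :* e) :* p :* d :* (y :* y :* u :* i)) refl _ _ _ _ _ _ _)

  Π-even-sucʳ : ∀ a n → Π even (suc (suc n)) a ≈ Π even (suc n) a * (even (suc n +ℕ a) * even⁻¹ (suc n))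
  Π-even-sucʳ a n = begin
    Π even (suc (suc n)) a                                        ≈⟨ insert-unit (even-inverse n) ⟩
    Π even (suc (suc n)) a * (even (suc n) * even⁻¹ (suc n))      ≈⟨ *-assoc _ _ _ ⟨
    Π even (suc (suc n)) a * even (suc n) * even⁻¹ (suc n)        ≈⟨ *-congʳ (Π-shift even (suc n) a) ⟩
    Π even (suc n) a * even (suc n +ℕ a) * even⁻¹ (suc n)         ≈⟨ *-assoc _ _ _ ⟩
    Π even (suc n) a * (even (suc n +ℕ a) * even⁻¹ (suc n))       ∎

  Π-odd⁻¹-sucʳ : ∀ a n → Π odd⁻¹ (suc n) a ≈ Π odd⁻¹ n a * (odd n * odd⁻¹ (n +ℕ a))
  Π-odd⁻¹-sucʳ a n = begin
    Π odd⁻¹ (suc n) a                          ≈⟨ insert-unit (odd-inverse n) ⟩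
    Π odd⁻¹ (suc n) a * (odd n * odd⁻¹ n)
      ≈⟨ solve 3 (λ a b c → a :* (b :* c) := a :* c :* b) refl _ _ _ ⟩
    Π odd⁻¹ (suc n) a * odd⁻¹ n * odd n        ≈⟨ *-congʳ (Π-shift odd⁻¹ n a) ⟩
    Π odd⁻¹ n a * odd⁻¹ (n +ℕ a) * odd n
      ≈⟨ solve 3 (λ a b c → a :* b :* c := a :* (c :* b)) refl _ _ _ ⟩
    Π odd⁻¹ n a * (odd n * odd⁻¹ (n +ℕ a))     ∎

  -- The index n is positive because the ratio of consecutive terms divides by 1 + Q^n.
  summand-sucʳ : ∀ a m → let n = suc m ; x = Q^ a ; y = Q^ n in
    summand a (suc n) ≈ summand a n *
        (y * y * y * y * Q * q * x * x * ((1# + y * x) * even⁻¹ n) * ((1# + q * y) * odd⁻¹ (n +ℕ a)))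
  summand-sucʳ a m = trans (*-cong
      (*-cong (*-congˡ (*-cong (E-sucʳ a n) (E-sucʳ a n)))
      (trans (Π-even-sucʳ a m) (*-congˡ (*-congʳ (+-congˡ (Q^-+ n a)))))) (Π-odd⁻¹-sucʳ a n))
    (solve 8 (λ t z x e p d i j → t :* z :* (x :* e :* (x :* e)) :* (p :* i) :* (d :* j)
         := t :* (e :* e) :* p :* d :* (z :* x :* x :* i :* j)) refl _ _ _ _ _ _ _ _)
    where n = suc m

  s-term : ℕ → ℕ → Carrier
  s-term a n = summand a n * even⁻¹ n * (1# + Q^ n * Q^ n * Q^ a)

  p : Carrier → Carrier → Carrier
  p x y = 1# + (1# + q * x) * y + x * y * y

  -- The multiple p(x,y) / (1 + q x y) of the summand whose differences in n yield the recurrence in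
  -- a, as in creative telescoping.
  g : ℕ → ℕ → Carrier
  g a n = summand a n * p (Q^ a) (Q^ n) * odd⁻¹ (n +ℕ a)

  odd-inverse-+ : ∀ n a → (1# + q * (Q^ n * Q^ a)) * odd⁻¹ (n +ℕ a) ≈ 1#
  odd-inverse-+ n a = trans (*-congʳ (+-congˡ (*-congˡ (sym (Q^-+ n a))))) (odd-inverse (n +ℕ a))

  -- The summands at a + 1, a + 2 and at n + 1 are all rational multiples of `summand a n`; with
  -- that as `t` the claim becomes `certificate`.
  s-telescopes : ∀ a m → let n = suc m in
    s-term a n + (1# + q * Q^ a) * s-term (suc a) n + Q * Q^ a * s-term (suc (suc a)) n
    ≈ g a n + g a (suc n)
  s-telescopes a m = begin
      _ ≈⟨ +-cong (+-congˡ (*-congˡ (*-congʳ (*-congʳ (summand-sucˡ a n)))))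
             (*-congˡ (*-congʳ (*-congʳ (trans (summand-sucˡ (suc a) n) (*-congʳ (summand-sucˡ a n)))))) ⟩
      _ ≈⟨ certificate (summand a n) (even⁻¹ n) (odd⁻¹ (n +ℕ a)) (odd⁻¹ (n +ℕ suc a)) q (Q^ a) (Q^ n)
             (even-inverse m) (odd-inverse-+ n a) (odd-inverse-+ n (suc a)) ⟩
      _ ≈⟨ +-congˡ (*-cong (*-congʳ (summand-sucʳ a m)) (reflexive (≡.cong odd⁻¹ (≡.sym (ℕₚ.+-suc n a))))) ⟨
      _ ∎
    where n = suc m

  P-Π : ∀ a → Π even 1 a * Π odd⁻¹ 0 a ≈ P a
  P-Π zero    = *-identityˡ 1#
  P-Π (suc a) = trans (solve 4 (λ p e o i → p :* e :* (o :* i)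
       := p :* o :* (e :* i)) refl _ _ _ _) (*-congʳ (P-Π a))

  -- The n = 0 terms fail the recurrence by exactly `g a 1`, which is also the lower end of the sum
  -- telescoped from n = 1.
  P-boundary : ∀ a → P a + (1# + q * Q^ a) * P (suc a) + Q * Q^ a * P (suc (suc a)) ≈ g a 1
  P-boundary a = begin
      P a + (1# + q * x) * P (suc a) + Q * x * P (suc (suc a))
        ≈⟨ +-congʳ (+-cong (trans (insert-unit h₁) (insert-unit h₂)) (*-congˡ (insert-unit h₂))) ⟩
      P a * ((1# + q * x) * i₁) * ((1# + q * (Q * x)) * i₂) + (1# + q * x) *
          (P a * ((1# + Q * x) * i₁) * ((1# + q * (Q * x)) * i₂)) + Q * x *
          (P a * ((1# + Q * x) * i₁) * ((1# + Q * (Q * x)) * i₂))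
        ≈⟨ solve 5 (λ t i₁ i₂ q x → let Q = q :* q ; 1′ = con true in
             t :* ((1′ :+ q :* x) :* i₁) :* ((1′ :+ q :* (Q :* x)) :* i₂) :+ (1′ :+ q :* x) :*
                 (t :* ((1′ :+ Q :* x) :* i₁) :* ((1′ :+ q :* (Q :* x)) :* i₂)) :+ Q :* x :*
                 (t :* ((1′ :+ Q :* x) :* i₁) :* ((1′ :+ Q :* (Q :* x)) :* i₂))
             := Q :* q :* (x :* x) :* t :* ((1′ :+ q) :* i₁) :* (1′ :+ (1′ :+ q :* x) :* Q :+ x :* Q :* Q)
                 :* i₂) refl (P a) i₁ i₂ q x ⟩
      Q * q * (x * x) * P a * ((1# + q) * i₁) * (1# + (1# + q * x) * Q + x * Q * Q) * i₂
        ≈⟨ *-congʳ (*-cong T₁ (+-cong (+-congˡ (*-congˡ Q≈)) (*-cong (*-congˡ Q≈) Q≈))) ⟨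
      g a 1 ∎
    where
    x = Q^ a ; i₁ = odd⁻¹ a ; i₂ = odd⁻¹ (suc a)
    h₁ : (1# + q * x) * i₁ ≈ 1#
    h₁ = odd-inverse a
    h₂ : (1# + q * (Q * x)) * i₂ ≈ 1#
    h₂ = odd-inverse (suc a)
    Q≈ : Q^ 1 ≈ Q
    Q≈ = *-identityʳ Q
    E≈ : E a 1 ≈ x
    E≈ = ^-congʳ Q (ℕₚ.*-identityʳ a)
    -- Trading `Π odd⁻¹ 1 a` for `Π odd⁻¹ 0 a` lets `P-Π` assemble the factor `P a`.
    T₁ : summand a 1 ≈ Q * q * (x * x) * P a * ((1# + q) * i₁)
    T₁ = begin
      summand a 1
        ≈⟨ *-cong (*-congʳ (*-congˡ (*-cong E≈ E≈))) (Π-odd⁻¹-sucʳ a 0) ⟩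
      1# * (1# * 1# * 1# * 1# * Q * q) * (x * x) * Π even 1 a * (Π odd⁻¹ 0 a * ((1# + q * 1#) * i₁))
        ≈⟨ solve 5 (λ q x e o i → let 1′ = con true in 1′ :* (1′ :* 1′ :* 1′ :* 1′ :* (q :* q) :* q) :*
            (x :* x) :* e :* (o :* ((1′ :+ q :* 1′) :* i))
              := q :* q :* q :* (x :* x) :* (e :* o) :* ((1′ :+ q) :* i)) refl q x (Π even 1 a)
                  (Π odd⁻¹ 0 a) i₁ ⟩
      Q * q * (x * x) * (Π even 1 a * Π odd⁻¹ 0 a) * ((1# + q) * i₁)
        ≈⟨ *-congʳ (*-congˡ (P-Π a)) ⟩
      Q * q * (x * x) * P a * ((1# + q) * i₁) ∎

  Q^≈q^ : ∀ n → Q^ n ≈ q ^ (n +ℕ n)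
  Q^≈q^ n = trans (^-distrib-* q q n) (sym (^-homo-* q n n))

  Θ≈q^θ : ∀ n → Θ n ≈ q ^ θ n
  Θ≈q^θ zero    = refl
  Θ≈q^θ (suc n) = begin
    Θ n * (y * y * y * y * Q * q)
      ≈⟨ *-cong (Θ≈q^θ n) (*-congʳ (*-congʳ (*-cong (*-cong (*-cong h h) h) h))) ⟩
    q ^ θ n * (z * z * z * z * Q * q)
      ≈⟨ solve 3 (λ t z q → t :* (z :* z :* z :* z :* (q :* q) :* q)
           := t :* ((z :* z) :* (z :* z)) :* (q :* (q :* (q :* con true)))) refl _ _ _ ⟩
    q ^ θ n * ((z * z) * (z * z)) * q ^ 3
      ≈⟨ *-congʳ (*-congˡ (trans (^-homo-* q (k +ℕ k) (k +ℕ k))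
          (*-cong (^-homo-* q k k) (^-homo-* q k k)))) ⟨
    q ^ θ n * q ^ ((k +ℕ k) +ℕ (k +ℕ k)) * q ^ 3  ≈⟨ *-congʳ (^-homo-* q (θ n) _) ⟨
    q ^ (θ n +ℕ ((k +ℕ k) +ℕ (k +ℕ k))) * q ^ 3  ≈⟨ ^-homo-* q (θ n +ℕ ((k +ℕ k) +ℕ (k +ℕ k))) 3 ⟨
    q ^ θ (suc n)                          ∎
    where
    y = Q^ n ; k = n +ℕ n ; z = q ^ k
    h : y ≈ z
    h = Q^≈q^ n

  n≤θn : ∀ n → n ≤ℕ θ n
  n≤θn zero    = z≤n
  n≤θn (suc n) = ≡.subst (suc n ≤ℕ_) (ℕₚ.+-comm 3 _)
    (s≤s (ℕₚ.≤-trans (n≤θn n) (ℕₚ.≤-trans (ℕₚ.m≤m+n _ _) (ℕₚ.m≤n+m _ 2))))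

  r : ℕ → Carrier
  r a = P a + Σ order (s-term a ∘ suc)

  -- The two copies of `g a 1`, from the n = 0 terms and from the telescoped sum, cancel modulo 2;
  -- the upper end `g a (suc order)` contains q^{θ(order+1)} and is zero.
  r-recurrence : ∀ a → r a ≈ (1# + q * Q^ a) * r (suc a) + Q * Q^ a * r (suc (suc a))
  r-recurrence a = x+y≈0⇒x≈y (begin
      r a + (u * r (suc a) + v * r (suc (suc a)))
        ≈⟨ solve 8 (λ p s u p′ s′ v p″ s″ → (p :+ s) :+ (u :* (p′ :+ s′) :+ v :* (p″ :+ s″))
             := (p :+ u :* p′ :+ v :* p″) :+ (s :+ u :* s′ :+ v :* s″)) refl _ _ _ _ _ _ _ _ ⟩
      (P a + u * P (suc a) + v * P (suc (suc a))) + (S a + u * S (suc a) + v * S (suc (suc a)))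
        ≈⟨ +-cong (P-boundary a) S-recurrence ⟩
      g a 1 + (g a 1 + g a (suc order))
        ≈⟨ +-congˡ (+-congˡ (annihilatesˡ _
            (annihilatesˡ _ (annihilatesˡ _ (annihilatesˡ _ (annihilatesˡ _ Θ≈0)))))) ⟩
      g a 1 + (g a 1 + 0#)
        ≈⟨ solve 1 (λ g → g :+ (g :+ con false) := con false) refl _ ⟩
      0# ∎)
    where
    u = 1# + q * Q^ a
    v = Q * Q^ a
    S : ℕ → Carrier
    S b = Σ order (s-term b ∘ suc)
    Θ≈0 : Θ (suc order) ≈ 0#
    Θ≈0 = trans (Θ≈q^θ (suc order)) (q^n≈0 (ℕₚ.≤-trans (ℕₚ.n≤1+n order) (n≤θn (suc order))))
    S-recurrence : S a + u * S (suc a) + v * S (suc (suc a)) ≈ g a 1 + g a (suc order)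
    S-recurrence = begin
      S a + u * S (suc a) + v * S (suc (suc a))
        ≈⟨ +-cong (trans (Σ-+ order _ _) (+-congˡ (Σ-* order u _))) (Σ-* order v _) ⟨
      Σ order (λ m → s-term a (suc m) + u * s-term (suc a) (suc m)) + Σ order
          (λ m → v * s-term (suc (suc a)) (suc m))
        ≈⟨ Σ-+ order _ _ ⟨
      Σ order (λ m → s-term a (suc m) + u * s-term (suc a) (suc m) + v * s-term (suc (suc a)) (suc m))
        ≈⟨ Σ-cong order (s-telescopes a) ⟩
      Σ order (λ m → g a (suc m) + g a (suc (suc m)))
        ≈⟨ Σ-telescope order (g a ∘ suc) ⟩
      g a 1 + g a (suc order) ∎

  r-limit : ∀ a → order ≤ℕ a → r a ≈ P a
  r-limit a h = trans (+-congˡ (Σ-zero order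
      (λ m → annihilatesˡ _ (annihilatesˡ _
      (annihilatesˡ _ (annihilatesˡ _ (annihilates _ (annihilatesˡ _ (E≈0 m h))))))))) (+-identityʳ _)

  P-limit : ∀ a → degree ≤ℕ a → P a ≈ P degree
  P-limit a h = trans (reflexive (≡.cong P (≡.sym (ℕₚ.m∸n+n≡m h)))) (P-stable (a ∸ degree))

  -- Downward induction on a, with `k` bounding the distance to the range a ≥ order where both sides
  -- equal ψ. The slack in the inequality lets the same `k` serve a + 1 and a + 2.
  f≈r : ∀ k a → order ≤ℕ k +ℕ a → P degree * f a ≈ r a
  f≈r zero    a h = begin
    P degree * f a  ≈⟨ *-congˡ (f-limit a h) ⟩
    P degree * 1#   ≈⟨ *-identityʳ _ ⟩
    P degree        ≈⟨ P-limit a (ℕₚ.≤-trans (ℕₚ.n≤1+n degree) h) ⟨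
    P a             ≈⟨ r-limit a h ⟨
    r a             ∎
  f≈r (suc k) a h = begin
    P degree * f a
      ≈⟨ *-congˡ (f-recurrence a) ⟩
    P degree * ((1# + q * Q^ a) * f (suc a) + Q * Q^ a * f (suc (suc a)))
      ≈⟨ solve 5 (λ p u f v f′ → p :* (u :* f :+ v :* f′)
           := u :* (p :* f) :+ v :* (p :* f′)) refl _ _ _ _ _ ⟩
    (1# + q * Q^ a) * (P degree * f (suc a)) + Q * Q^ a * (P degree * f (suc (suc a)))
      ≈⟨ +-cong (*-congˡ (f≈r k (suc a) h′))
          (*-congˡ (f≈r k (suc (suc a)) (ℕₚ.≤-trans h′ (ℕₚ.+-monoʳ-≤ k (ℕₚ.n≤1+n (suc a)))))) ⟩
    (1# + q * Q^ a) * r (suc a) + Q * Q^ a * r (suc (suc a))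
      ≈⟨ r-recurrence a ⟨
    r a ∎
    where
    h′ : order ≤ℕ k +ℕ suc a
    h′ = ≡.subst (order ≤ℕ_) (≡.sym (ℕₚ.+-suc k a)) h

  -- Gauss's identity for ψ

  w : ℕ → ℕ → Carrier
  w n s = q ^ s * E n s

  w-sucˡ : ∀ n s → w (suc n) s ≈ Q^ s * w n s
  w-sucˡ n s = trans (*-congˡ (E-sucˡ n s)) (solve 3 (λ a b c → a :* (b :* c) := b :* (a :* c)) refl _ _ _)

  w-sucʳ : ∀ n s → w n (suc s) ≈ q * Q^ n * w n s
  w-sucʳ n s = trans (*-congˡ (E-sucʳ n s)) (solve 4 (λ a b c d → a :* b :* (c :* d)
       := a :* c :* (b :* d)) refl _ _ _ _)

  -- Shanks's finite form of Gauss's identity, with w n s = q^{s(2n+1)}.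
  shanks : ∀ n → P n * Σ n (λ s → P⁻¹ s * w n s) ≈ Σ n (λ m → w m m * odd m)
  shanks zero    = zeroʳ _
  shanks (suc n) = begin
      P n * (e * i) * (A + P⁻¹ n * w (suc n) n)
        ≈⟨ *-congˡ (+-congˡ (*-congˡ (w-sucˡ n n))) ⟩
      P n * (e * i) * (A + P⁻¹ n * (y * ω))
        ≈⟨ solve 7 (λ p e i a p′ y w → p :* (e :* i) :* (a :+ p′ :* (y :* w))
             := p :* i :* (e :* a) :+ e :* i :* (p :* p′) :* (y :* w)) refl _ _ _ _ _ _ _ ⟩
      P n * i * (e * A) + e * i * (P n * P⁻¹ n) * (y * ω)
        ≈⟨ +-congʳ (*-congˡ eA) ⟩
      P n * i * (o * B + even n * P⁻¹ n * ω) + e * i * (P n * P⁻¹ n) * (y * ω)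
        ≈⟨ solve 9 (λ p i o b e p′ w e′ y → p :* i :* (o :* b :+ e :* p′ :* w) :+ e′ :* i :* (p :* p′) :*
            (y :* w)
             := p :* b :* (o :* i) :+ i :* w :* (e :+ e′ :* y) :* (p :* p′)) refl _ _ _ _ _ _ _ _ _ ⟩
      P n * B * (o * i) + i * ω * (even n + e * y) * (P n * P⁻¹ n)
        ≈⟨ +-cong (insert-unit (odd-inverse n)) (insert-unit (P-inverse n)) ⟨
      P n * B + i * ω * (even n + e * y)
        ≈⟨ +-congˡ (solve 4 (λ i w q y → i :* w :* ((con true :+ y) :+ (con true :+ q :* q :* y) :* y)
             := w :* (con true :+ q :* y) :* ((con true :+ q :* y) :* i)) refl i ω q y) ⟩
      P n * B + ω * o * (o * i)
        ≈⟨ +-cong (shanks n) (sym (insert-unit (odd-inverse n))) ⟩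
      Σ n (λ m → w m m * odd m) + ω * o ∎
    where
    e = even (suc n) ; o = odd n ; i = odd⁻¹ n ; y = Q^ n ; ω = w n n
    A = Σ n (λ s → P⁻¹ s * w (suc n) s)
    B = Σ n (λ s → P⁻¹ s * w n s)
    -- Consecutive values of `G` add up to the s-th term of `e * A + o * B`, and `G 0` is zero
    -- because `even 0` is 1 + 1; this converts the sum `A` into the sum `B` of the induction
    -- hypothesis.
    G : ℕ → Carrier
    G s = even s * P⁻¹ s * w n s
    G-step : ∀ s → e * (P⁻¹ s * w (suc n) s) + o * (P⁻¹ s * w n s) ≈ G s + G (suc s)
    G-step s = begin
      e * (P⁻¹ s * w (suc n) s) + o * (P⁻¹ s * w n s)
        ≈⟨ +-congʳ (*-congˡ (*-congˡ (w-sucˡ n s))) ⟩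
      e * (P⁻¹ s * (Q^ s * w n s)) + o * (P⁻¹ s * w n s)
        ≈⟨ solve 5 (λ q y p z w → let 1′ = con true in (1′ :+ q :* q :* y) :* (p :* (z :* w)) :+
            (1′ :+ q :* y) :* (p :* w)
             := (1′ :+ z) :* p :* w :+ (1′ :+ q :* z) :* p :* (q :* y :* w)) refl q y (P⁻¹ s) (Q^ s)
                 (w n s) ⟩
      G s + odd s * P⁻¹ s * (q * y * w n s)
        ≈⟨ +-congˡ (trans (insert-unit (even-inverse s)) (solve 5 (λ o p w e e′ → o :* p :* w :* (e :* e′)
             := e :* (p :* (o :* e′)) :* w) refl _ _ _ _ _)) ⟩
      G s + even (suc s) * (P⁻¹ s * (odd s * even⁻¹ (suc s))) * (q * y * w n s)
        ≈⟨ +-congˡ (*-congˡ (w-sucʳ n s)) ⟨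
      G s + G (suc s) ∎
    eA : e * A ≈ o * B + G n
    eA = begin
      e * A                              ≈⟨ solve 2 (λ a b → a := (a :+ b) :+ b) refl _ (o * B) ⟩
      e * A + o * B + o * B              ≈⟨ +-congʳ (+-cong (Σ-* n e _) (Σ-* n o _)) ⟨
      Σ n _ + Σ n _ + o * B              ≈⟨ +-congʳ (Σ-+ n _ _) ⟨
      Σ n _ + o * B                      ≈⟨ +-congʳ (trans (Σ-cong n G-step) (Σ-telescope n G)) ⟩
      G 0 + G n + o * B                  ≈⟨ +-congʳ (+-congʳ (annihilatesˡ _ (annihilatesˡ _ 1+1≈0))) ⟩
      0# + G n + o * B                   ≈⟨ solve 2 (λ a b → con false :+ a :+ b := b :+ a) refl _ _ ⟩
      o * B + G n                        ∎

  -- Shanks's identity is taken at n = order, where only s = 0 survives on the left. On the right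
  -- m(2m+1) and (m+1)(2m+1) are the triangular numbers of even and odd index.
  gauss : P degree ≈ Σ order (λ m → w m m * odd m)
  gauss = begin
    P degree                                              ≈⟨ P-stable 1 ⟨
    P order                                               ≈⟨ *-identityʳ _ ⟨
    P order * 1#                                          ≈⟨ *-congˡ (begin
        Σ order t                                             ≈⟨ Σ-shift degree t ⟩
        t 0 + Σ degree (t ∘ suc)
          ≈⟨ +-cong (*-congˡ (*-congˡ (^-congʳ Q (ℕₚ.*-zeroʳ order))))
              (Σ-zero degree (λ s → annihilates _ (annihilates _ (E≈0 s ℕₚ.≤-refl)))) ⟩
        1# * (1# * 1#) + 0#
          ≈⟨ solve 0 (con true :* (con true :* con true) :+ con false := con true) refl ⟩
        1#                                                    ∎) ⟨
    P order * Σ order t                                   ≈⟨ shanks order ⟩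
    Σ order (λ m → w m m * odd m)                         ∎
    where
    t : ℕ → Carrier
    t s = P⁻¹ s * w order s

  -- At x = 1 the shifted factorials are empty and (1 + y²) / (1 + y) = 1 + y modulo 2, which yields
  -- the exponents 4n² - n and 4n² + n.
  s-zero : ∀ m → s-term 0 (suc m) ≈ Θ (suc m) * even (suc m)
  s-zero m = trans
    (solve 3 (λ t i y → let 1′ = con true in t :* (1′ :* 1′) :* 1′ :* 1′ :* i :* (1′ :+ y :* y :* 1′)
         := t :* (1′ :+ y) :* ((1′ :+ y) :* i)) refl (Θ (suc m)) (even⁻¹ (suc m)) (Q^ (suc m)))
    (sym (insert-unit (even-inverse m)))

  -- The j = 0 term, equal to ψ, is added to complete `f 0` and subtracted again; `gauss` expands
  -- the subtracted copy.
  theta-products : Σ degree (λ j → P degree * (P⁻¹ (suc j) * q ^ (suc j *ℕ suc j)))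
       ≈ 1# + Σ order (λ m → Θ (suc m) * even (suc m)) + Σ order (λ m → w m m * odd m)
  theta-products = begin
    Σ degree (λ j → P degree * (P⁻¹ (suc j) * q ^ (suc j *ℕ suc j)))
      ≈⟨ Σ-* degree _ _ ⟩
    P degree * Σ degree (λ j → P⁻¹ (suc j) * q ^ (suc j *ℕ suc j))
      ≈⟨ *-congˡ (Σ-cong degree (λ j → sym (*-identityʳ _))) ⟩
    P degree * Σ degree (f-term 0 ∘ suc)
      ≈⟨ solve 2 (λ p s → p :* s := p :* (con true :* con true :* con true :+ s) :+ p) refl _ _ ⟩
    P degree * (f-term 0 0 + Σ degree (f-term 0 ∘ suc)) + P degree
      ≈⟨ +-congʳ (*-congˡ (Σ-shift degree (f-term 0))) ⟨
    P degree * f 0 + P degree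
      ≈⟨ +-cong (f≈r order 0 (ℕₚ.m≤m+n order 0)) gauss ⟩
    1# + Σ order (s-term 0 ∘ suc) + Σ order (λ m → w m m * odd m)
      ≈⟨ +-congʳ (+-congˡ (Σ-cong order s-zero)) ⟩
    1# + Σ order (λ m → Θ (suc m) * even (suc m)) + Σ order (λ m → w m m * odd m) ∎

  q^double : ∀ i → q ^ double i ≈ Q^ i
  q^double zero    = refl
  q^double (suc i) = trans (sym (*-assoc q q _)) (*-congˡ (q^double i))

  -- Below 2J only the odd bounds contribute, by q, q³, ..., q^{2J-1}, whose product is q^{J²}; from
  -- there on each pair of bounds contributes the ratio of consecutive values of `P`. For
  -- unrestricted odd parts the factor 1 + q^{2i+1} stands on the left, which is the form obtained
  -- by removing one copy of the part.
  restricted-product : ∀ J (V : ℕ → Carrier) → V 0 ≈ 1# →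
    (∀ i → i < J → V (suc (double i)) ≈ q ^ suc (double i) * V (double i)) →
    (∀ i → i < J → V (double (suc i)) ≈ V (suc (double i))) →
    (∀ i → J ≤ℕ i → (1# + q ^ suc (double i)) * V (suc (double i)) ≈ V (double i)) →
    (∀ i → J ≤ℕ i → V (double (suc i)) ≈ (1# + q ^ double (suc i)) * V (suc (double i))) →
    ∀ k → V (double (k +ℕ J)) ≈ P (k +ℕ J) * (P⁻¹ J * q ^ (J *ℕ J))
  restricted-product J V V₀ odd< even< odd≥ even≥ = high
    where
    low : ∀ i → i ≤ℕ J → V (double i) ≈ q ^ (i *ℕ i)
    low zero    _   = V₀
    low (suc i) i<J = begin
      V (double (suc i))                   ≈⟨ even< i i<J ⟩
      V (suc (double i))                   ≈⟨ odd< i i<J ⟩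
      q ^ suc (double i) * V (double i)    ≈⟨ *-cong (*-congˡ (q^double i)) (low i (ℕₚ.<⇒≤ i<J)) ⟩
      q * Q^ i * q ^ (i *ℕ i)              ≈⟨ *-comm _ _ ⟩
      q ^ (i *ℕ i) * (q * Q^ i)            ≈⟨ q^suc² i ⟨
      q ^ (suc i *ℕ suc i)                 ∎
    high : ∀ k → V (double (k +ℕ J)) ≈ P (k +ℕ J) * (P⁻¹ J * q ^ (J *ℕ J))
    high zero    = begin
      V (double J)                   ≈⟨ low J ℕₚ.≤-refl ⟩
      q ^ (J *ℕ J)                   ≈⟨ insert-unit (P-inverse J) ⟩
      q ^ (J *ℕ J) * (P J * P⁻¹ J)   ≈⟨ solve 3 (λ a b c → a :* (b :* c) := b :* (c :* a)) refl _ _ _ ⟩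
      P J * (P⁻¹ J * q ^ (J *ℕ J))   ∎
    high (suc k) = begin
      V (double (suc i))                             ≈⟨ even≥ i J≤i ⟩
      (1# + q ^ double (suc i)) * V (suc (double i)) ≈⟨ *-cong (+-congˡ (q^double (suc i))) odd-step ⟩
      even (suc i) * (odd⁻¹ i * V (double i))        ≈⟨ *-congˡ (*-congˡ (high k)) ⟩
      even (suc i) * (odd⁻¹ i * (P i * c))
        ≈⟨ solve 4 (λ e o p c → e :* (o :* (p :* c)) := p :* (e :* o) :* c) refl _ _ _ _ ⟩
      P (suc i) * c                                  ∎
      where
      i = k +ℕ J
      c = P⁻¹ J * q ^ (J *ℕ J)
      J≤i : J ≤ℕ i
      J≤i = ℕₚ.m≤n+m J k
      odd-step : V (suc (double i)) ≈ odd⁻¹ i * V (double i)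
      odd-step = begin
        V (suc (double i))                                          ≈⟨ insert-unit (odd-inverse i) ⟩
        V (suc (double i)) * (odd i * odd⁻¹ i)
          ≈⟨ solve 3 (λ v o i → v :* (o :* i) := i :* (o :* v)) refl _ _ _ ⟩
        odd⁻¹ i * (odd i * V (suc (double i)))
          ≈⟨ *-congˡ (*-congʳ (+-congˡ (*-congˡ (q^double i)))) ⟨
        odd⁻¹ i * ((1# + q ^ suc (double i)) * V (suc (double i)))  ≈⟨ *-congˡ (odd≥ i J≤i) ⟩
        odd⁻¹ i * V (double i)                                      ∎

  theta-monomials : Σ degree (λ j → P degree * (P⁻¹ (suc j) * q ^ (suc j *ℕ suc j)))
    ≈ 1# + Σ order (λ m → q ^ θ (suc m) + q ^ (θ (suc m) +ℕ (suc m +ℕ suc m)))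
         + Σ order (λ m → q ^ τ m + q ^ (τ m +ℕ suc (m +ℕ m)))
  theta-monomials = trans theta-products (+-cong (+-congˡ (Σ-cong order first)) (Σ-cong order second))
    where
    first : ∀ m → Θ (suc m) * even (suc m) ≈ q ^ θ (suc m) + q ^ (θ (suc m) +ℕ (suc m +ℕ suc m))
    first m = begin
      Θ n * (1# + Q^ n)                        ≈⟨ *-cong (Θ≈q^θ n) (+-congˡ (Q^≈q^ n)) ⟩
      q ^ θ n * (1# + q ^ (n +ℕ n))            ≈⟨ distribˡ _ _ _ ⟩
      q ^ θ n * 1# + q ^ θ n * q ^ (n +ℕ n)    ≈⟨ +-cong (*-identityʳ _) (sym (^-homo-* q (θ n) (n +ℕ n))) ⟩
      q ^ θ n + q ^ (θ n +ℕ (n +ℕ n))          ∎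
      where n = suc m
    second : ∀ m → w m m * odd m ≈ q ^ τ m + q ^ (τ m +ℕ suc (m +ℕ m))
    second m = begin
      w m m * odd m                                ≈⟨ *-cong w≈ (+-congˡ (*-congˡ (Q^≈q^ m))) ⟩
      q ^ τ m * (1# + q ^ suc (m +ℕ m))            ≈⟨ distribˡ _ _ _ ⟩
      q ^ τ m * 1# + q ^ τ m * q ^ suc (m +ℕ m)
        ≈⟨ +-cong (*-identityʳ _) (sym (^-homo-* q (τ m) (suc (m +ℕ m)))) ⟩
      q ^ τ m + q ^ (τ m +ℕ suc (m +ℕ m))          ∎
      where
      w≈ : w m m ≈ q ^ τ m
      w≈ = trans (*-congˡ (Q^≈q^ (m *ℕ m))) (sym (^-homo-* q m _))

-- The ring 𝔽₂[[q]]

Series : Set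
Series = ℕ → Bool

infixl 6 _⊕_
infixl 7 _⊛_

𝟘 𝟙 𝕢 : Series
𝟘 _       = false
𝟙 zero    = true
𝟙 (suc _) = false
𝕢 zero    = false
𝕢 (suc n) = 𝟙 n

_⊕_ _⊛_ : Series → Series → Series
(f ⊕ g) n       = f n xor g n
(f ⊛ g) zero    = f 0 ∧ g 0
(f ⊛ g) (suc n) = (f 0 ∧ g (suc n)) xor (f ∘ suc ⊛ g) n

⊛-cong : ∀ {f f′ g g′} n → (∀ {i} → i ≤ℕ n → f i ≡ f′ i) → (∀ {i} → i ≤ℕ n → g i ≡ g′ i) → (f ⊛ g) n ≡
    (f′ ⊛ g′) n
⊛-cong zero    h k = cong₂ _∧_ (h z≤n) (k z≤n)
⊛-cong (suc n) h k = cong₂ _xor_ (cong₂ _∧_ (h z≤n) (k ℕₚ.≤-refl)) (⊛-cong n (h ∘ s≤s) (k ∘ ℕₚ.m≤n⇒m≤1+n))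

⊛-zeroˡ : ∀ f n → (𝟘 ⊛ f) n ≡ false
⊛-zeroˡ f zero    = ≡.refl
⊛-zeroˡ f (suc n) = ⊛-zeroˡ f n

⊛-identityˡ : ∀ f n → (𝟙 ⊛ f) n ≡ f n
⊛-identityˡ f zero    = ≡.refl
⊛-identityˡ f (suc n) = ≡.trans (cong (f (suc n) xor_) (⊛-zeroˡ f n)) (xor-identityʳ _)

⊛-distribʳ : ∀ h f g n → ((f ⊕ g) ⊛ h) n ≡ (f ⊛ h) n xor (g ⊛ h) n
⊛-distribʳ h f g zero    = ∧-distribʳ-xor (h 0) (f 0) (g 0)
⊛-distribʳ h f g (suc n) = ≡.trans
  (cong₂ _xor_ (∧-distribʳ-xor (h (suc n)) (f 0) (g 0)) (⊛-distribʳ h (f ∘ suc) (g ∘ suc) n))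
  (interchange (f 0 ∧ h (suc n)) (g 0 ∧ h (suc n)) _ _)

-- Peels the Cauchy product at the end opposite to the definition; comparing the two ends turns
-- commutativity into an induction.
⊛-sucʳ : ∀ f g n → (f ⊛ g) (suc n) ≡ (f (suc n) ∧ g 0) xor (f ⊛ (g ∘ suc)) n
⊛-sucʳ f g zero    = xor-comm (f 0 ∧ g 1) (f 1 ∧ g 0)
⊛-sucʳ f g (suc n) = ≡.trans (cong ((f 0 ∧ g (suc (suc n))) xor_) (⊛-sucʳ (f ∘ suc) g n))
    (x∙yz≈y∙xz (f 0 ∧ g (suc (suc n))) (f (suc (suc n)) ∧ g 0) _)

⊛-comm : ∀ f g n → (f ⊛ g) n ≡ (g ⊛ f) n
⊛-comm f g zero    = ∧-comm (f 0) (g 0)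
⊛-comm f g (suc n) = ≡.trans (cong₂ _xor_ (∧-comm (f 0) (g (suc n))) (⊛-comm (f ∘ suc) g n))
    (≡.sym (⊛-sucʳ g f n))

⊛-scale : ∀ b f g n → (((b ∧_) ∘ f) ⊛ g) n ≡ b ∧ (f ⊛ g) n
⊛-scale true  f g n = ≡.refl
⊛-scale false f g n = ⊛-zeroˡ g n

⊛-assoc : ∀ f g h n → ((f ⊛ g) ⊛ h) n ≡ (f ⊛ (g ⊛ h)) n
⊛-assoc f g h zero    = ∧-assoc (f 0) (g 0) (h 0)
⊛-assoc f g h (suc n) = begin
  ((f 0 ∧ g 0) ∧ h (suc n)) xor (((f ⊛ g) ∘ suc) ⊛ h) n
    ≡⟨ cong₂ _xor_ (∧-assoc (f 0) (g 0) (h (suc n))) (⊛-distribʳ h ((f 0 ∧_) ∘ g ∘ suc) (f ∘ suc ⊛ g) n) ⟩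
  (f 0 ∧ (g 0 ∧ h (suc n))) xor ((((f 0 ∧_) ∘ g ∘ suc) ⊛ h) n xor ((f ∘ suc ⊛ g) ⊛ h) n)
    ≡⟨ cong ((f 0 ∧ (g 0 ∧ h (suc n))) xor_)
        (cong₂ _xor_ (⊛-scale (f 0) (g ∘ suc) h n) (⊛-assoc (f ∘ suc) g h n)) ⟩
  (f 0 ∧ (g 0 ∧ h (suc n))) xor ((f 0 ∧ (g ∘ suc ⊛ h) n) xor (f ∘ suc ⊛ (g ⊛ h)) n)
    ≡⟨ xor-assoc (f 0 ∧ (g 0 ∧ h (suc n))) _ _ ⟨
  ((f 0 ∧ (g 0 ∧ h (suc n))) xor (f 0 ∧ (g ∘ suc ⊛ h) n)) xor (f ∘ suc ⊛ (g ⊛ h)) n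
    ≡⟨ cong (_xor (f ∘ suc ⊛ (g ⊛ h)) n) (∧-distribˡ-xor (f 0) _ _) ⟨
  (f 0 ∧ (g ⊛ h) (suc n)) xor (f ∘ suc ⊛ (g ⊛ h)) n ∎
  where open ≡.≡-Reasoning

-- Series are never cut off: congruence modulo q^{d+1} serves as the equality of the quotient ring.
record EqualUpTo (d : ℕ) (f g : Series) : Set where
  constructor upTo
  field coeff : ∀ i → i ≤ℕ d → f i ≡ g i
open EqualUpTo

module _ (d : ℕ) where
  open ≡.≡-Reasoning


  seriesSemiring : CommutativeSemiring 0ℓ 0ℓ
  seriesSemiring = record
    { Carrier = Series
    ; _≈_ = EqualUpTo d
    ; _+_ = _⊕_ ; _*_ = _⊛_ ; 0# = 𝟘 ; 1# = 𝟙
    ; isCommutativeSemiring = isCommutativeSemiringˡ record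
      { +-isCommutativeMonoid = record
        { isMonoid = record
          { isSemigroup = record
            { isMagma = record { isEquivalence = isEquivalence ; ∙-cong = λ h k → upTo λ i i≤d → cong₂ _xor_
                (coeff h i i≤d) (coeff k i i≤d) }
            ; assoc = λ f g h → upTo λ i _ → xor-assoc (f i) (g i) (h i) }
          ; identity = (λ f → upTo λ i _ → ≡.refl) , (λ f → upTo λ i _ → xor-identityʳ (f i)) }
        ; comm = λ f g → upTo λ i _ → xor-comm (f i) (g i) }
      ; *-isCommutativeMonoid = record
        { isMonoid = record
          { isSemigroup = record
            { isMagma = record
              { isEquivalence = isEquivalence
              ; ∙-cong = λ h k → upTo λ i i≤d → ⊛-cong i (λ j≤i → coeff h _ (ℕₚ.≤-trans j≤i i≤d))
                  (λ j≤i → coeff k _ (ℕₚ.≤-trans j≤i i≤d)) }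
            ; assoc = λ f g h → upTo λ i _ → ⊛-assoc f g h i }
          ; identity = (λ f → upTo λ i _ → ⊛-identityˡ f i) ,
              (λ f → upTo λ i _ → ≡.trans (⊛-comm f 𝟙 i) (⊛-identityˡ f i)) }
        ; comm = λ f g → upTo λ i _ → ⊛-comm f g i }
      ; distribʳ = λ h f g → upTo λ i _ → ⊛-distribʳ h f g i
      ; zeroˡ = λ f → upTo λ i _ → ⊛-zeroˡ f i
      }
    }
    where
    isEquivalence : IsEquivalence (EqualUpTo d)
    isEquivalence = record
      { refl  = upTo λ _ _ → ≡.refl
      ; sym   = λ h → upTo λ i i≤d → ≡.sym (coeff h i i≤d)
      ; trans = λ h k → upTo λ i i≤d → ≡.trans (coeff h i i≤d) (coeff k i i≤d)
      }

  open Algebra.Properties.CommutativeSemiring.Exp seriesSemiring using (_^_)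

  coeff-𝕢^ : ∀ k n → n ≢ k → (𝕢 ^ k) n ≡ false
  coeff-𝕢^ zero    zero    n≢k = contradiction ≡.refl n≢k
  coeff-𝕢^ zero    (suc n) n≢k = ≡.refl
  coeff-𝕢^ (suc k) zero    n≢k = ≡.refl
  coeff-𝕢^ (suc k) (suc n) n≢k = ≡.trans (⊛-identityˡ (𝕢 ^ k) n) (coeff-𝕢^ k n (n≢k ∘ cong suc))

  coeff-𝕢^⊛ : ∀ k f n → (𝕢 ^ k ⊛ f) n ≡ (k ≤ᵇ n) ∧ f (n ∸ k)
  coeff-𝕢^⊛ zero    f n       = ⊛-identityˡ f n
  coeff-𝕢^⊛ (suc k) f zero    = ≡.refl
  coeff-𝕢^⊛ (suc k) f (suc n) = begin
    (𝕢 ⊛ 𝕢 ^ k ⊛ f) (suc n)    ≡⟨ ⊛-assoc 𝕢 (𝕢 ^ k) f (suc n) ⟩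
    (𝟙 ⊛ (𝕢 ^ k ⊛ f)) n        ≡⟨ ⊛-identityˡ (𝕢 ^ k ⊛ f) n ⟩
    (𝕢 ^ k ⊛ f) n              ≡⟨ coeff-𝕢^⊛ k f n ⟩
    (k ≤ᵇ n) ∧ f (n ∸ k)       ≡⟨ cong (_∧ f (n ∸ k)) (≤ᵇ-suc k) ⟩
    (k <ᵇ suc n) ∧ f (n ∸ k)   ∎
    where
    ≤ᵇ-suc : ∀ k → (k ≤ᵇ n) ≡ (k <ᵇ suc n)
    ≤ᵇ-suc zero    = ≡.refl
    ≤ᵇ-suc (suc k) = ≡.refl

  truncatedPowerSeries : TruncatedSeries
  truncatedPowerSeries = record
    { commutativeSemiring = seriesSemiring
    ; 1+1≈0 = upTo λ { zero _ → ≡.refl ; (suc i) _ → ≡.refl }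
    ; q = 𝕢
    ; degree = d
    ; q^[1+degree]≈0 = upTo λ i i≤d → coeff-𝕢^ (suc d) i (λ { ≡.refl → ℕₚ.<-irrefl ≡.refl i≤d })
    }

-- Parities of counts of partitions

par : {A : Set} → (A → Bool) → List A → Bool
par p []       = false
par p (x ∷ xs) = p x xor par p xs

par-false⇒even : {A : Set} (p : A → Bool) (xs : List A) → par p xs ≡ false → 2 ∣ length (filterᵇ p xs)
par-false⇒even p xs h = odd?-even _ (≡.trans (≡.sym (par-odd? xs)) h)
  where
  odd? : ℕ → Bool
  odd? zero    = false
  odd? (suc n) = not (odd? n)
  odd?-even : ∀ n → odd? n ≡ false → 2 ∣ n
  odd?-even zero          _ = divides 0 ≡.refl
  odd?-even (suc zero)    ()
  odd?-even (suc (suc n)) h with odd?-even n (≡.trans (≡.sym (not-involutive (odd? n))) h)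
  ... | divides k eq = divides (suc k) (cong (suc ∘ suc) eq)
  par-odd? : ∀ xs → par p xs ≡ odd? (length (filterᵇ p xs))
  par-odd? []       = ≡.refl
  par-odd? (x ∷ xs) with p x
  ... | true  = cong not (par-odd? xs)
  ... | false = par-odd? xs

module _ {A : Set} (p : A → Bool) where
  par-++ : ∀ xs ys → par p (xs ++ ys) ≡ par p xs xor par p ys
  par-++ []       ys = ≡.refl
  par-++ (x ∷ xs) ys = ≡.trans (cong (p x xor_) (par-++ xs ys)) (≡.sym (xor-assoc (p x) _ _))

  par-map : ∀ {B : Set} (f : B → A) xs → par p (map f xs) ≡ par (p ∘ f) xs
  par-map f []       = ≡.refl
  par-map f (x ∷ xs) = cong (p (f x) xor_) (par-map f xs)

  par-concatMap : ∀ {B : Set} (f : B → List A) xs → par p (concatMap f xs) ≡ par (par p ∘ f) xs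
  par-concatMap f []       = ≡.refl
  par-concatMap f (x ∷ xs) = ≡.trans (par-++ (f x) (concatMap f xs))
      (cong (par p (f x) xor_) (par-concatMap f xs))

  par-filterᵇ : ∀ r xs → par p (filterᵇ r xs) ≡ par (λ x → r x ∧ p x) xs
  par-filterᵇ r []       = ≡.refl
  par-filterᵇ r (x ∷ xs) with r x
  ... | true  = cong (p x xor_) (par-filterᵇ r xs)
  ... | false = par-filterᵇ r xs

  par-cong : ∀ {p′ xs} → All (λ x → p x ≡ p′ x) xs → par p xs ≡ par p′ xs
  par-cong []       = ≡.refl
  par-cong (h ∷ hs) = cong₂ _xor_ h (par-cong hs)

  par-applyUpTo-suc : ∀ f n → par p (applyUpTo f (suc n)) ≡ par p (applyUpTo f n) xor p (f n)
  par-applyUpTo-suc f n = ≡.trans (cong (par p) (≡.sym (Listₚ.applyUpTo-∷ʳ f n)))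
    (≡.trans (par-++ (applyUpTo f n) [ f n ]) (cong (par p (applyUpTo f n) xor_) (xor-identityʳ (p (f n)))))

par-cartesianProduct : ∀ {A B : Set} (p : A × B → Bool) xs ys → par p (cartesianProduct xs ys) ≡ par
    (λ x → par (λ y → p (x , y)) ys) xs
par-cartesianProduct p []       ys = ≡.refl
par-cartesianProduct p (x ∷ xs) ys = ≡.trans (par-++ p (map (x ,_) ys) _)
  (cong₂ _xor_ (par-map p (x ,_) ys) (par-cartesianProduct p xs ys))

par-false : ∀ {A : Set} (xs : List A) → par (λ _ → false) xs ≡ false
par-false []       = ≡.refl
par-false (x ∷ xs) = par-false xs

-- Counting by the largest part

<ᵇ-suc : ∀ m n → (m <ᵇ suc n) ≡ (m <ᵇ n) xor (m ≡ᵇ n)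
<ᵇ-suc zero    zero    = ≡.refl
<ᵇ-suc zero    (suc n) = ≡.refl
<ᵇ-suc (suc m) zero    = ≡.refl
<ᵇ-suc (suc m) (suc n) = <ᵇ-suc m n

≡ᵇ-transport : ∀ (h : ℕ → Bool) m n → (m ≡ᵇ n) ∧ h m ≡ (n ≡ᵇ m) ∧ h n
≡ᵇ-transport h zero    zero    = ≡.refl
≡ᵇ-transport h zero    (suc n) = ≡.refl
≡ᵇ-transport h (suc m) zero    = ≡.refl
≡ᵇ-transport h (suc m) (suc n) = ≡ᵇ-transport (h ∘ suc) m n

-- Raising the bound admits the single new value `suc m`, and only if the list reaches it.
par-bound-suc : ∀ h m N →
  par (λ k → (k ≤ᵇ suc m) ∧ h k) (applyUpTo suc N) ≡ par (λ k → (k ≤ᵇ m) ∧ h k) (applyUpTo suc N) xor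
      ((m <ᵇ N) ∧ h (suc m))
par-bound-suc h m zero    = ≡.refl
par-bound-suc h m (suc N) = begin
  par P₁ (applyUpTo suc (suc N))
    ≡⟨ par-applyUpTo-suc P₁ suc N ⟩
  par P₁ (applyUpTo suc N) xor ((N <ᵇ suc m) ∧ a)
    ≡⟨ cong₂ _xor_ (par-bound-suc h m N)
        (≡.trans (cong (_∧ a) (<ᵇ-suc N m)) (∧-distribʳ-xor a (N <ᵇ m) (N ≡ᵇ m))) ⟩
  (S xor ((m <ᵇ N) ∧ b)) xor (((N <ᵇ m) ∧ a) xor ((N ≡ᵇ m) ∧ a))
    ≡⟨ cong ((S xor ((m <ᵇ N) ∧ b)) xor_) (cong (((N <ᵇ m) ∧ a) xor_) (≡ᵇ-transport (h ∘ suc) N m)) ⟩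
  (S xor ((m <ᵇ N) ∧ b)) xor (((N <ᵇ m) ∧ a) xor ((m ≡ᵇ N) ∧ b))
    ≡⟨ interchange S ((m <ᵇ N) ∧ b) ((N <ᵇ m) ∧ a) ((m ≡ᵇ N) ∧ b) ⟩
  (S xor ((N <ᵇ m) ∧ a)) xor (((m <ᵇ N) ∧ b) xor ((m ≡ᵇ N) ∧ b))
    ≡⟨ cong₂ _xor_ (par-applyUpTo-suc P₀ suc N)
        (≡.trans (cong (_∧ b) (<ᵇ-suc m N)) (∧-distribʳ-xor b (m <ᵇ N) (m ≡ᵇ N))) ⟨
  par P₀ (applyUpTo suc (suc N)) xor ((m <ᵇ suc N) ∧ b) ∎
  where
  open ≡.≡-Reasoning
  P₁ P₀ : ℕ → Bool
  P₁ k = (k ≤ᵇ suc m) ∧ h k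
  P₀ k = (k ≤ᵇ m) ∧ h k
  a b S : Bool
  a = h (suc N)
  b = h (suc m)
  S = par P₀ (applyUpTo suc N)

withLargest : ℕ → ℕ → ℕ → List (List ℕ)
withLargest f n k = map (k ∷_) (partsBounded f (suc n ∸ k) k)

-- `V` ties the fuel to the size, while the recursive calls may have fuel to spare; independence of
-- the fuel turns their counts back into values of `V`.
partsBounded-fuel : ∀ f f′ n m → n ≤ℕ f → n ≤ℕ f′ → partsBounded f n m ≡ partsBounded f′ n m
partsBounded-fuel f       f′       zero    m _         _          = ≡.refl
partsBounded-fuel (suc f) (suc f′) (suc n) m (s≤s n≤f) (s≤s n≤f′) =
  cong concat (Listₚ.map-cong-local {f = withLargest f n} {g = withLargest f′ n}
    (Allₚ.filter⁺ (T? ∘ (_≤ᵇ m)) (Allₚ.applyUpTo⁺₂ suc (suc n) λ i → cong (map (suc i ∷_))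
      (partsBounded-fuel f f′ (n ∸ i) (suc i) (ℕₚ.≤-trans (ℕₚ.m∸n≤m n i) n≤f)
          (ℕₚ.≤-trans (ℕₚ.m∸n≤m n i) n≤f′)))))

-- V p m is the generating function mod 2 of the partitions with parts at most m that satisfy p.
V : (List ℕ → Bool) → ℕ → ℕ → Bool
V p m n = par p (partsBounded n n m)

V-first-part : ∀ p m n → V p m (suc n) ≡ par
    (λ k → (k ≤ᵇ m) ∧ par (p ∘ (k ∷_)) (partsBounded n (suc n ∸ k) k)) (applyUpTo suc (suc n))
V-first-part p m n = ≡.trans (par-concatMap p (withLargest n n) (filterᵇ (_≤ᵇ m) (applyUpTo suc (suc n))))
  (≡.trans (par-filterᵇ (par p ∘ withLargest n n) (_≤ᵇ m) (applyUpTo suc (suc n)))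
    (par-cong (λ k → (k ≤ᵇ m) ∧ par p (withLargest n n k))
        (All.universal (λ k → cong ((k ≤ᵇ m) ∧_) (par-map p (k ∷_) (partsBounded n (suc n ∸ k) k)))
        (applyUpTo suc (suc n)))))

-- Either no part equals m + 1, or the first part does; removing it leaves a list with parts still
-- at most m + 1, tested with that part put back.
V-suc : ∀ p m n → V p (suc m) n ≡ V p m n xor ((m <ᵇ n) ∧ V (p ∘ (suc m ∷_)) (suc m) (n ∸ suc m))
V-suc p m zero    = ≡.sym (xor-identityʳ _)
V-suc p m (suc n) = ≡.trans (V-first-part p (suc m) n)
  (≡.trans (par-bound-suc (λ k → par (p ∘ (k ∷_)) (partsBounded n (suc n ∸ k) k)) m (suc n))
    (cong₂ _xor_ (≡.sym (V-first-part p m n))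
      (cong (λ xs → (m <ᵇ suc n) ∧ par (p ∘ (suc m ∷_)) xs)
        (partsBounded-fuel n (n ∸ m) (n ∸ m) (suc m) (ℕₚ.m∸n≤m n m) ℕₚ.≤-refl))))

V-zero : ∀ p n → V p 0 (suc n) ≡ false
V-zero p n = ≡.trans (V-first-part p 0 n) (≡.trans
  (par-cong (λ k → (k ≤ᵇ 0) ∧ par (p ∘ (k ∷_)) (partsBounded n (suc n ∸ k) k)) {p′ = λ _ → false}
      (Allₚ.applyUpTo⁺₂ suc (suc n) (λ i → ≡.refl))) (par-false (applyUpTo suc (suc n))))

V-large-bound : ∀ p n k → V p (k +ℕ n) n ≡ V p n n
V-large-bound p n zero    = ≡.refl
V-large-bound p n (suc k) = ≡.trans (V-suc p (k +ℕ n) n)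
  (≡.trans (cong (λ b → V p (k +ℕ n) n xor
      (b ∧ V (p ∘ (suc (k +ℕ n) ∷_)) (suc (k +ℕ n)) (n ∸ suc (k +ℕ n)))) (k+n≮ᵇn k))
    (≡.trans (xor-identityʳ _) (V-large-bound p n k)))
  where
  k+n≮ᵇn : ∀ k → (k +ℕ n <ᵇ n) ≡ false
  k+n≮ᵇn k with k +ℕ n <ᵇ n in eq
  ... | false = ≡.refl
  ... | true  = contradiction (ℕₚ.<ᵇ⇒< (k +ℕ n) n (Equivalence.from T-≡ eq)) (ℕₚ.≤⇒≯ (ℕₚ.m≤n+m n k))

-- Properties of the enumerated lists

data Bounded : ℕ → ℕ → List ℕ → Set where
  []   : ∀ {m} → Bounded m 0 []
  cons : ∀ {m n k λs} → suc k ≤ℕ m → Bounded (suc k) n λs → Bounded m (suc k +ℕ n) (suc k ∷ λs)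

partsBounded-bounded : ∀ f n m → n ≤ℕ f → All (Bounded m n) (partsBounded f n m)
partsBounded-bounded f       zero    m _         = [] ∷ []
partsBounded-bounded (suc f) (suc n) m (s≤s n≤f) =
  Allₚ.concat⁺ (Allₚ.map⁺ (All.map step (All.zip
    ( Allₚ.all-filter (T? ∘ (_≤ᵇ m)) (applyUpTo suc (suc n))
    , Allₚ.filter⁺ (T? ∘ (_≤ᵇ m)) (Allₚ.applyUpTo⁺₁ suc (suc n) (λ {i} i<1+n → i , i<1+n , ≡.refl))))))
  where
  step : ∀ {k} → T (k ≤ᵇ m) × (∃ λ i → i < suc n × k ≡ suc i) → All (Bounded m (suc n)) (withLargest f n k)
  step (k≤m , i , s≤s i≤n , ≡.refl) = Allₚ.map⁺ (All.map
    (λ {λs} b → ≡.subst (λ t → Bounded m t (suc i ∷ λs)) (cong suc (ℕₚ.m+[n∸m]≡n i≤n))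
        (cons (ℕₚ.≤ᵇ⇒≤ (suc i) m k≤m) b))
    (partsBounded-bounded f (n ∸ i) (suc i) (ℕₚ.≤-trans (ℕₚ.m∸n≤m n i) n≤f)))

Bounded⇒All : ∀ {m n λs} → Bounded m n λs → All (λ p → 0 < p × p ≤ℕ m) λs
Bounded⇒All []         = []
Bounded⇒All (cons h b) = (s≤s z≤n , h) ∷ All.map (λ { (0<p , p≤k) → 0<p , ℕₚ.≤-trans p≤k h })
    (Bounded⇒All b)

T⇒≡true : ∀ {b} → T b → b ≡ true
T⇒≡true = Equivalence.to T-≡

Bounded⇒nonIncreasing : ∀ {m n λs} → Bounded m n λs → T (nonIncreasingᵇ λs)
Bounded⇒nonIncreasing []                        = tt
Bounded⇒nonIncreasing (cons h [])               = tt
Bounded⇒nonIncreasing (cons h b@(cons h′ _))    = Equivalence.from T-∧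
    (ℕₚ.≤⇒≤ᵇ h′ , Bounded⇒nonIncreasing b)

Bounded⇒sum : ∀ {m n λs} → Bounded m n λs → sum λs ≡ n
Bounded⇒sum []                 = ≡.refl
Bounded⇒sum (cons {k = k} _ b) = cong (suc k +ℕ_) (Bounded⇒sum b)

All⇒allᵇ : ∀ {A : Set} {p : A → Bool} {xs} → All (T ∘ p) xs → T (allᵇ p xs)
All⇒allᵇ []       = tt
All⇒allᵇ (h ∷ hs) = Equivalence.from T-∧ (h , All⇒allᵇ hs)

allᵇ⇒All : ∀ {A : Set} {p : A → Bool} xs → T (allᵇ p xs) → All (T ∘ p) xs
allᵇ⇒All []       _ = []
allᵇ⇒All (x ∷ xs) h = proj₁ (Equivalence.to T-∧ h) ∷ allᵇ⇒All xs (proj₂ (Equivalence.to T-∧ h))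

Bounded⇒isPartition : ∀ {m n λs} → Bounded m n λs → T (isPartitionᵇ n λs)
Bounded⇒isPartition b = Equivalence.from T-∧ (Bounded⇒nonIncreasing b , Equivalence.from T-∧
  (All⇒allᵇ (All.map (ℕₚ.<⇒<ᵇ ∘ proj₁) (Bounded⇒All b)) , ℕₚ.≡⇒≡ᵇ _ _ (Bounded⇒sum b)))

-- Admissibility as separate conditions on multiplicities

-- The condition that goodᵇ j puts on the multiplicity c of the part k.
ok : ℕ → ℕ → ℕ → Bool
ok j k c = if evenᵇ k then (if 2 *ℕ j <ᵇ k then c ≤ᵇ 1 else c ≡ᵇ 0) else
    (if k <ᵇ 2 *ℕ j then c ≡ᵇ 1 else true)

okUpTo : ℕ → ℕ → List ℕ → Bool
okUpTo j zero    λs = true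
okUpTo j (suc m) λs = ok j (suc m) (occ (suc m) λs) ∧ okUpTo j m λs

okUpTo⇒ok : ∀ j m λs → T (okUpTo j m λs) → ∀ {k} → 0 < k → k ≤ℕ m → T (ok j k (occ k λs))
okUpTo⇒ok j zero    λs _ {suc k} _ ()
okUpTo⇒ok j (suc m) λs h 0<k k≤m with ℕₚ.m≤n⇒m<n∨m≡n k≤m
... | inj₁ (s≤s k≤m′) = okUpTo⇒ok j m λs (proj₂ (Equivalence.to T-∧ h)) 0<k k≤m′
... | inj₂ ≡.refl     = proj₁ (Equivalence.to T-∧ h)

ok⇒okUpTo : ∀ j m λs → (∀ {k} → 0 < k → k ≤ℕ m → T (ok j k (occ k λs))) → T (okUpTo j m λs)
ok⇒okUpTo j zero    λs h = tt
ok⇒okUpTo j (suc m) λs h = Equivalence.from T-∧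
    (h (s≤s z≤n) ℕₚ.≤-refl , ok⇒okUpTo j m λs (λ 0<k k≤m → h 0<k (ℕₚ.m≤n⇒m≤1+n k≤m)))

≡ᵇ-refl : ∀ n → (n ≡ᵇ n) ≡ true
≡ᵇ-refl n = T⇒≡true (ℕₚ.≡⇒≡ᵇ n n ≡.refl)

occ≡0⊎∈ : ∀ k λs → occ k λs ≡ 0 ⊎ k ∈ λs
occ≡0⊎∈ k []       = inj₁ ≡.refl
occ≡0⊎∈ k (x ∷ λs) with k ≡ᵇ x in eq
... | true  = inj₂ (here (ℕₚ.≡ᵇ⇒≡ k x (Equivalence.from T-≡ eq)))
... | false with occ≡0⊎∈ k λs
...   | inj₁ h = inj₁ h
...   | inj₂ h = inj₂ (there h)

∈⇒0<occ : ∀ {k λs} → k ∈ λs → 0 < occ k λs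
∈⇒0<occ {k} (here ≡.refl) rewrite ≡ᵇ-refl k = s≤s z≤n
∈⇒0<occ {k} (there h)     = ℕₚ.≤-trans (∈⇒0<occ h) (ℕₚ.m≤n+m _ _)

evenᵇ-2*i+1 : ∀ i → evenᵇ (2 *ℕ i +ℕ 1) ≡ false
evenᵇ-2*i+1 zero    = ≡.refl
evenᵇ-2*i+1 (suc i) rewrite ℕₚ.+-suc i (i +ℕ 0) = evenᵇ-2*i+1 i

oddᵇ⇒2*i+1 : ∀ k → evenᵇ k ≡ false → ∃ λ i → k ≡ 2 *ℕ i +ℕ 1
oddᵇ⇒2*i+1 (suc zero)    h = 0 , ≡.refl
oddᵇ⇒2*i+1 (suc (suc k)) h with oddᵇ⇒2*i+1 k h
... | i , ≡.refl = suc i , cong suc (cong (_+ℕ 1) (≡.sym (ℕₚ.+-suc i (i +ℕ 0))))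

<⇒2*i+1<2*j : ∀ {i j} → i < j → 2 *ℕ i +ℕ 1 < 2 *ℕ j
<⇒2*i+1<2*j {i} {j} i<j = ℕₚ.≤-trans
    (ℕₚ.≤-reflexive (≡.trans (cong suc (ℕₚ.+-comm (2 *ℕ i) 1)) (≡.sym (ℕₚ.*-suc 2 i)))) (ℕₚ.*-monoʳ-≤ 2 i<j)

module _ {j λs} (h : T (goodᵇ j λs)) where
  good-odd : ∀ {i} → i < j → T (occ (2 *ℕ i +ℕ 1) λs ≡ᵇ 1)
  good-odd = Allₚ.applyUpTo⁻ (λ i → i) j
    (allᵇ⇒All _ (proj₁ (Equivalence.to T-∧ (proj₂ (Equivalence.to (T-∧ {0 <ᵇ j}) h)))))

  good-even : ∀ {k} → k ∈ λs → T (not (evenᵇ k) ∨ ((2 *ℕ j <ᵇ k) ∧ (occ k λs ≡ᵇ 1)))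
  good-even = All.lookup (allᵇ⇒All λs
      (proj₂ (Equivalence.to (T-∧ {allᵇ (λ i → occ (2 *ℕ i +ℕ 1) λs ≡ᵇ 1) (applyUpTo (λ i → i) j)})
    (proj₂ (Equivalence.to (T-∧ {0 <ᵇ j}) h)))))

  -- For even k, `goodᵇ` speaks only of parts that occur, hence the split on occurrence:
  -- multiplicity 0 passes either even test, and an occurring k must exceed 2j and have multiplicity
  -- 1. An odd k below 2j is one of the prescribed 2i + 1.
  good⇒ok : ∀ k → T (ok j k (occ k λs))
  good⇒ok k with evenᵇ k in even-k | occ≡0⊎∈ k λs
  ... | false | _ with k <ᵇ 2 *ℕ j in k<2j
  ...   | false = tt
  ...   | true with oddᵇ⇒2*i+1 k even-k
  ...     | i , ≡.refl = good-odd (ℕₚ.*-cancelˡ-< 2 i j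
    (ℕₚ.≤-trans (ℕₚ.≤-reflexive (ℕₚ.+-comm 1 (2 *ℕ i))) (ℕₚ.<⇒≤ (ℕₚ.<ᵇ⇒< _ _ (Equivalence.from T-≡ k<2j)))))
  good⇒ok k | true | inj₁ occ≡0 rewrite occ≡0 with 2 *ℕ j <ᵇ k
  ... | true  = tt
  ... | false = tt
  good⇒ok k | true | inj₂ k∈λs with good-even k∈λs
  ... | c rewrite even-k with 2 *ℕ j <ᵇ k
  ...   | true  rewrite ℕₚ.≡ᵇ⇒≡ (occ k λs) 1 c = tt
  ...   | false = contradiction c id

ok⇒good : ∀ {j L λs} → 0 < j → 2 *ℕ j ≤ℕ L → All (λ p → 0 < p × p ≤ℕ L) λs →
  (∀ {k} → 0 < k → k ≤ℕ L → T (ok j k (occ k λs))) → T (goodᵇ j λs)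
ok⇒good {j} {L} {λs} 0<j 2j≤L bounds h = Equivalence.from T-∧ (ℕₚ.<⇒<ᵇ 0<j , Equivalence.from T-∧
  ( All⇒allᵇ (Allₚ.applyUpTo⁺₁ (λ i → i) j odds) , All⇒allᵇ (All.tabulate evens)))
  where
  odds : ∀ {i} → i < j → T (occ (2 *ℕ i +ℕ 1) λs ≡ᵇ 1)
  odds {i} i<j with h (ℕₚ.m≤n+m 1 (2 *ℕ i)) (ℕₚ.≤-trans (ℕₚ.<⇒≤ (<⇒2*i+1<2*j i<j)) 2j≤L)
  ... | c rewrite evenᵇ-2*i+1 i | T⇒≡true (ℕₚ.<⇒<ᵇ (<⇒2*i+1<2*j i<j)) = c
  evens : ∀ {p} → p ∈ λs → T (not (evenᵇ p) ∨ ((2 *ℕ j <ᵇ p) ∧ (occ p λs ≡ᵇ 1)))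
  evens {p} p∈λs with uncurry h (All.lookup bounds p∈λs) | ∈⇒0<occ p∈λs
  ... | c | 0<occ with evenᵇ p
  ...   | false = tt
  ...   | true with 2 *ℕ j <ᵇ p
  ...     | true  = ℕₚ.≡⇒≡ᵇ _ 1 (ℕₚ.≤-antisym (ℕₚ.≤ᵇ⇒≤ _ 1 c) 0<occ)
  ...     | false = contradiction (≡.sym (ℕₚ.≡ᵇ⇒≡ _ 0 c)) (ℕₚ.<⇒≢ 0<occ)

T-ext : ∀ {a b} → (T a → T b) → (T b → T a) → a ≡ b
T-ext {true}  {true}  f g = ≡.refl
T-ext {true}  {false} f g = contradiction (f tt) id
T-ext {false} {true}  f g = contradiction (g tt) id
T-ext {false} {false} f g = ≡.refl

-- Replaces a test of the whole list by one independent test per part size, so that the generating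
-- function factors. The range L must cover 2j for the prescribed odd parts and m for the parts that
-- occur.
good≡okUpTo : ∀ {j m n L λs} → 0 < j → 2 *ℕ j ≤ℕ L → m ≤ℕ L → Bounded m n λs →
  isPartitionᵇ n λs ∧ goodᵇ j λs ≡ okUpTo j L λs
good≡okUpTo {j} {m} {n} {L} {λs} 0<j 2j≤L m≤L b = T-ext
  (λ h → ok⇒okUpTo j L λs (λ {k} _ _ → good⇒ok {j} {λs}
      (proj₂ (Equivalence.to (T-∧ {isPartitionᵇ n λs}) h)) k))
  (λ h → Equivalence.from T-∧ (Bounded⇒isPartition b ,
    ok⇒good 0<j 2j≤L (All.map (λ { (0<p , p≤m) → 0<p , ℕₚ.≤-trans p≤m m≤L }) (Bounded⇒All b))
        (okUpTo⇒ok j L λs h)))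

V-cong : ∀ {p p′ m} n → (∀ {λs} → Bounded m n λs → p λs ≡ p′ λs) → V p m n ≡ V p′ m n
V-cong {p} {m = m} n h = par-cong p (All.map h (partsBounded-bounded n n m ℕₚ.≤-refl))

<⇒≡ᵇ-false : ∀ {m n} → m < n → (m ≡ᵇ n) ≡ false
<⇒≡ᵇ-false {zero}  (s≤s _)   = ≡.refl
<⇒≡ᵇ-false {suc m} (s≤s m<n) = <⇒≡ᵇ-false m<n

>⇒≡ᵇ-false : ∀ {m n} → n < m → (m ≡ᵇ n) ≡ false
>⇒≡ᵇ-false {n = zero}  (s≤s _)   = ≡.refl
>⇒≡ᵇ-false {n = suc n} (s≤s n<m) = >⇒≡ᵇ-false n<m

occ-above : ∀ {m λs} → All (λ p → 0 < p × p ≤ℕ m) λs → occ (suc m) λs ≡ 0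
occ-above []                = ≡.refl
occ-above ((_ , p≤m) ∷ ps) rewrite >⇒≡ᵇ-false (s≤s p≤m) = occ-above ps

okUpTo-∷ : ∀ j m {m′} λs → m ≤ℕ m′ → okUpTo j m (suc m′ ∷ λs) ≡ okUpTo j m λs
okUpTo-∷ j zero    λs _    = ≡.refl
okUpTo-∷ j (suc m) λs m<m′ rewrite <⇒≡ᵇ-false m<m′ = cong (ok j (suc m) (occ (suc m) λs) ∧_)
    (okUpTo-∷ j m λs (ℕₚ.<⇒≤ m<m′))

double≡2* : ∀ i → 2 *ℕ i ≡ double i
double≡2* zero    = ≡.refl
double≡2* (suc i) = cong suc (≡.trans (ℕₚ.+-suc i (i +ℕ 0)) (cong suc (double≡2* i)))

evenᵇ-double : ∀ i → evenᵇ (double (suc i)) ≡ true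
evenᵇ-double zero    = ≡.refl
evenᵇ-double (suc i) = evenᵇ-double i

evenᵇ-suc-double : ∀ i → evenᵇ (suc (double i)) ≡ false
evenᵇ-suc-double zero    = ≡.refl
evenᵇ-suc-double (suc i) = evenᵇ-suc-double i

suc-double<ᵇdouble : ∀ i j → (suc (double i) <ᵇ double j) ≡ (i <ᵇ j)
suc-double<ᵇdouble i       zero    = ≡.refl
suc-double<ᵇdouble zero    (suc j) = ≡.refl
suc-double<ᵇdouble (suc i) (suc j) = suc-double<ᵇdouble i j

double<ᵇdouble : ∀ i j → (double i <ᵇ double j) ≡ (i <ᵇ j)
double<ᵇdouble i       zero    = ≡.refl
double<ᵇdouble zero    (suc j) = ≡.refl
double<ᵇdouble (suc i) (suc j) = double<ᵇdouble i j

<ᵇ-true : ∀ {m n} → m < n → (m <ᵇ n) ≡ true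
<ᵇ-true = T⇒≡true ∘ ℕₚ.<⇒<ᵇ

<ᵇ-false : ∀ {m n} → n ≤ℕ m → (m <ᵇ n) ≡ false
<ᵇ-false {m} {n} n≤m with m <ᵇ n in eq
... | false = ≡.refl
... | true  = contradiction (ℕₚ.<ᵇ⇒< m n (Equivalence.from T-≡ eq)) (ℕₚ.≤⇒≯ n≤m)

module _ {i j : ℕ} (c : ℕ) where
  ok-odd< : i < j → ok j (suc (double i)) c ≡ (c ≡ᵇ 1)
  ok-odd< i<j rewrite evenᵇ-suc-double i | double≡2* j | suc-double<ᵇdouble i j | <ᵇ-true i<j = ≡.refl

  ok-odd≥ : j ≤ℕ i → ok j (suc (double i)) c ≡ true
  ok-odd≥ j≤i rewrite evenᵇ-suc-double i | double≡2* j | suc-double<ᵇdouble i j | <ᵇ-false j≤i = ≡.refl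

  ok-even< : i < j → ok j (double (suc i)) c ≡ (c ≡ᵇ 0)
  ok-even< i<j rewrite evenᵇ-double i | double≡2* j | double<ᵇdouble j (suc i) | <ᵇ-false i<j = ≡.refl

  ok-even≥ : j ≤ℕ i → ok j (double (suc i)) c ≡ (c ≤ᵇ 1)
  ok-even≥ j≤i rewrite evenᵇ-double i | double≡2* j | double<ᵇdouble j (suc i) | <ᵇ-true (s≤s j≤i) = ≡.refl

-- The generating function for a fixed j, and the parity of `c₂`

module GeneratingFunction (d : ℕ) where
  open TruncatedSeries (truncatedPowerSeries d)
  open QSeries (truncatedPowerSeries d)
  open Relation.Binary.Reasoning.Setoid setoid

  V-suc≈ : ∀ p m → V p (suc m) ≈ V p m + q ^ suc m * V (p ∘ (suc m ∷_)) (suc m)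
  V-suc≈ p m = upTo λ n _ → ≡.trans (V-suc p m n) (cong (V p m n xor_) (≡.sym (coeff-𝕢^⊛ d (suc m) _ n)))

  -- The part `suc m` is governed only by the test `o` on its multiplicity, and `π` ignores it.
  -- Peeling off its copies one at a time produces V π m times the sum of q^{c(m+1)} over the
  -- multiplicities c allowed by `o`.
  module Multiplicity (o : ℕ → Bool) (π : List ℕ → Bool) (m : ℕ) (π-∷ : ∀ λs → π (suc m ∷ λs) ≡ π λs) where
    U : ℕ → Carrier
    U c = V (λ λs → o (c +ℕ occ (suc m) λs) ∧ π λs) (suc m)

    -- c counts the parts suc m that have already been removed.
    U-step : ∀ c → U c ≈ fromBool (o c) * V π m + q ^ suc m * U (suc c)
    U-step c = begin
      U c
        ≈⟨ V-suc≈ _ m ⟩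
      V (λ λs → o (c +ℕ occ (suc m) λs) ∧ π λs) m + q ^ suc m * V
          (λ λs → o (c +ℕ occ (suc m) (suc m ∷ λs)) ∧ π (suc m ∷ λs)) (suc m)
        ≈⟨ +-cong (upTo λ n _ → absent n)
            (*-congˡ (upTo λ n _ → V-cong n λ {λs} _ → cong₂ _∧_ (cong o (occ-suc λs)) (π-∷ λs))) ⟩
      V (λ λs → o c ∧ π λs) m + q ^ suc m * U (suc c)
        ≈⟨ +-congʳ (scale (o c)) ⟩
      fromBool (o c) * V π m + q ^ suc m * U (suc c) ∎
      where
      absent : ∀ n → V (λ λs → o (c +ℕ occ (suc m) λs) ∧ π λs) m n ≡ V (λ λs → o c ∧ π λs) m n
      absent n = V-cong n λ {λs} b → cong (λ e → o e ∧ π λs)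
          (≡.trans (cong (c +ℕ_) (occ-above (Bounded⇒All b))) (ℕₚ.+-identityʳ c))
      occ-suc : ∀ λs → c +ℕ occ (suc m) (suc m ∷ λs) ≡ suc c +ℕ occ (suc m) λs
      occ-suc λs rewrite ≡ᵇ-refl m = ℕₚ.+-suc c _
      scale : ∀ b → V (λ λs → b ∧ π λs) m ≈ fromBool b * V π m
      scale true  = sym (*-identityˡ (V π m))
      scale false = trans (upTo λ n _ → par-false (partsBounded n n m)) (sym (zeroˡ (V π m)))

    U≈0 : ∀ c → (∀ e → o (c +ℕ e) ≡ false) → U c ≈ 0#
    U≈0 c h = upTo λ n _ → ≡.trans (V-cong n λ {λs} _ → cong (_∧ π λs) (h (occ (suc m) λs)))
        (par-false (partsBounded n n (suc m)))

    U-last : ∀ c → o c ≡ true → (∀ e → o (suc c +ℕ e) ≡ false) → U c ≈ V π m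
    U-last c h h′ = begin
      U c                                              ≈⟨ U-step c ⟩
      fromBool (o c) * V π m + q ^ suc m * U (suc c)
        ≈⟨ +-cong (*-congʳ (reflexive (cong fromBool h))) (annihilates (q ^ suc m) (U≈0 (suc c) h′)) ⟩
      1# * V π m + 0#
        ≈⟨ trans (+-identityʳ (1# * V π m)) (*-identityˡ (V π m)) ⟩
      V π m                                            ∎

  module _ (j : ℕ) where
    W : ℕ → Carrier
    W m = V (okUpTo j m) m

    module _ (m : ℕ) where
      okUpTo-∷-suc : ∀ λs → okUpTo j m (suc m ∷ λs) ≡ okUpTo j m λs
      okUpTo-∷-suc λs = okUpTo-∷ j m λs ℕₚ.≤-refl

      module M (o : ℕ → Bool) = Multiplicity o (okUpTo j m) m okUpTo-∷-suc

      W-suc : ∀ o → (∀ c → ok j (suc m) c ≡ o c) → W (suc m) ≈ M.U o 0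
      W-suc o h = upTo λ n _ → V-cong n λ {λs} _ → cong (_∧ okUpTo j m λs) (h (occ (suc m) λs))

      W-exactlyOne : (∀ c → ok j (suc m) c ≡ (c ≡ᵇ 1)) → W (suc m) ≈ q ^ suc m * W m
      W-exactlyOne h = begin
        W (suc m)                             ≈⟨ W-suc (_≡ᵇ 1) h ⟩
        M.U (_≡ᵇ 1) 0                         ≈⟨ M.U-step (_≡ᵇ 1) 0 ⟩
        0# * W m + q ^ suc m * M.U (_≡ᵇ 1) 1
          ≈⟨ +-cong (zeroˡ (W m)) (*-congˡ (M.U-last (_≡ᵇ 1) 1 ≡.refl (λ _ → ≡.refl))) ⟩
        0# + q ^ suc m * W m                  ≈⟨ +-identityˡ (q ^ suc m * W m) ⟩
        q ^ suc m * W m                       ∎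

      W-none : (∀ c → ok j (suc m) c ≡ (c ≡ᵇ 0)) → W (suc m) ≈ W m
      W-none h = trans (W-suc (_≡ᵇ 0) h) (M.U-last (_≡ᵇ 0) 0 ≡.refl (λ _ → ≡.refl))

      W-atMostOne : (∀ c → ok j (suc m) c ≡ (c ≤ᵇ 1)) → W (suc m) ≈ (1# + q ^ suc m) * W m
      W-atMostOne h = begin
        W (suc m)                             ≈⟨ W-suc (_≤ᵇ 1) h ⟩
        M.U (_≤ᵇ 1) 0                         ≈⟨ M.U-step (_≤ᵇ 1) 0 ⟩
        1# * W m + q ^ suc m * M.U (_≤ᵇ 1) 1
          ≈⟨ +-congˡ {x = 1# * W m} (*-congˡ (M.U-last (_≤ᵇ 1) 1 ≡.refl (λ _ → ≡.refl))) ⟩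
        1# * W m + q ^ suc m * W m            ≈⟨ distribʳ (W m) 1# (q ^ suc m) ⟨
        (1# + q ^ suc m) * W m                ∎

      W-any : (∀ c → ok j (suc m) c ≡ true) → (1# + q ^ suc m) * W (suc m) ≈ W m
      W-any h = begin
        (1# + q ^ suc m) * W (suc m)                              ≈⟨ distribʳ (W (suc m)) 1# (q ^ suc m) ⟩
        1# * W (suc m) + q ^ suc m * W (suc m)
          ≈⟨ +-congʳ (trans (*-identityˡ (W (suc m)))
              (trans (W-suc (λ _ → true) h) (M.U-step (λ _ → true) 0))) ⟩
        -- For the constant test `U 1` and `U 0` are definitionally equal, so the recursion leads
        -- back to `W (suc m)` and the two copies cancel modulo 2.
        1# * W m + q ^ suc m * M.U (λ _ → true) 0 + q ^ suc m * W (suc m)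
          ≈⟨ +-congʳ (+-cong (*-identityˡ (W m)) (*-congˡ (sym (W-suc (λ _ → true) h)))) ⟩
        W m + q ^ suc m * W (suc m) + q ^ suc m * W (suc m)
          ≈⟨ +-assoc (W m) (q ^ suc m * W (suc m)) (q ^ suc m * W (suc m)) ⟩
        W m + (q ^ suc m * W (suc m) + q ^ suc m * W (suc m))
          ≈⟨ +-congˡ {x = W m} (x+x≈0 (q ^ suc m * W (suc m))) ⟩
        W m + 0#                                                  ≈⟨ +-identityʳ (W m) ⟩
        W m                                                       ∎

    W≈product : j ≤ℕ d → W (double d) ≈ P d * (P⁻¹ j * q ^ (j *ℕ j))
    W≈product j≤d = ≡.subst (λ N → W (double N) ≈ P N * (P⁻¹ j * q ^ (j *ℕ j))) (ℕₚ.m∸n+n≡m j≤d)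
      (restricted-product j W
        (upTo λ { zero _ → ≡.refl ; (suc n) _ → V-zero (λ _ → true) n })
        (λ i i<j → W-exactlyOne (double i) (λ c → ok-odd< c i<j))
        (λ i i<j → W-none (suc (double i)) (λ c → ok-even< c i<j))
        (λ i j≤i → W-any (double i) (λ c → ok-odd≥ c j≤i))
        (λ i j≤i → W-atMostOne (suc (double i)) (λ c → ok-even≥ c j≤i))
        (d ∸ j))

  double≡+ : ∀ i → double i ≡ i +ℕ i
  double≡+ i = ≡.trans (≡.sym (double≡2* i)) (cong (i +ℕ_) (ℕₚ.+-identityʳ i))

  -- The conditions concern parts up to 2 (j + 1), possibly above d, so the tests run up to
  -- `double d`; `V-large-bound` raises the bound of the enumeration to match.
  par-good : ∀ j → j < d → par (λ λs → isPartitionᵇ d λs ∧ goodᵇ (suc j) λs) (partitions d) ≡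
      (P d * (P⁻¹ (suc j) * q ^ (suc j *ℕ suc j))) d
  par-good j j<d = ≡.trans
    (V-cong {p = λ λs → isPartitionᵇ d λs ∧ goodᵇ (suc j) λs} d (good≡okUpTo (s≤s z≤n)
      (≡.subst (_≤ℕ double d) (≡.sym (double≡2* (suc j)))
          (≡.subst₂ _≤ℕ_ (≡.sym (double≡+ (suc j))) (≡.sym (double≡+ d)) (ℕₚ.+-mono-≤ j<d j<d)))
      (≡.subst (d ≤ℕ_) (≡.sym (double≡+ d)) (ℕₚ.m≤m+n d d))))
    (≡.trans
      (≡.trans (≡.sym (V-large-bound (okUpTo (suc j) (double d)) d d))
          (cong (λ L → V (okUpTo (suc j) (double d)) L d) (≡.sym (double≡+ d))))
      (EqualUpTo.coeff (W≈product (suc j) j<d) d ℕₚ.≤-refl))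

  par-Σ : ∀ (h : ℕ → Bool) F i n → (∀ j → j < n → h (suc j) ≡ F j i) → par h (applyUpTo suc n) ≡ Σ n F i
  par-Σ h F i zero    _ = ≡.refl
  par-Σ h F i (suc n) e = ≡.trans (par-applyUpTo-suc h suc n)
    (cong₂ _xor_ (par-Σ h F i n (λ j j<n → e j (ℕₚ.m≤n⇒m≤1+n j<n))) (e n ℕₚ.≤-refl))

  Σ-coeff-false : ∀ n F i → (∀ j → F j i ≡ false) → Σ n F i ≡ false
  Σ-coeff-false zero    F i h = ≡.refl
  Σ-coeff-false (suc n) F i h = cong₂ _xor_ (Σ-coeff-false n F i h) (h n)

  -- The truncation degree is the index of the coefficient to be read off, so j has the same range
  -- 1, ..., d in `c₂` and in `theta-monomials`.
  c₂-even : d ≢ 0 →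
    (∀ n → d ≢ θ n) → (∀ n → d ≢ θ n +ℕ (n +ℕ n)) →
    (∀ n → d ≢ τ n) → (∀ n → d ≢ τ n +ℕ suc (n +ℕ n)) →
    2 ∣ c₂ d
  c₂-even d≢0 d≢θ d≢θ′ d≢τ d≢τ′ = par-false⇒even _ (cartesianProduct (applyUpTo suc d) (partitions d))
      (≡.trans (par-cartesianProduct _ (applyUpTo suc d) (partitions d))
    (≡.trans (par-Σ _ (λ j → P d * (P⁻¹ (suc j) * q ^ (suc j *ℕ suc j))) d d par-good)
      (≡.trans (EqualUpTo.coeff theta-monomials d ℕₚ.≤-refl)
        (cong₂ _xor_ (cong₂ _xor_ (coeff-𝕢^ d 0 d d≢0)
          (Σ-coeff-false order _ d (λ m → cong₂ _xor_ (coeff-𝕢^ d _ d (d≢θ (suc m)))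
              (coeff-𝕢^ d _ d (d≢θ′ (suc m))))))
          (Σ-coeff-false order _ d (λ m → cong₂ _xor_ (coeff-𝕢^ d _ d (d≢τ m))
              (coeff-𝕢^ d _ d (d≢τ′ m))))))))

-- The residues of `e` modulo 5 have period 5, so five values decide; `k n` is the quotient of
-- e(n+5) - e(n) by 5.
shift-by-5 : ∀ (e : ℕ → ℕ) (k : ℕ → ℕ) → (∀ n → e (5 +ℕ n) ≡ e n +ℕ k n *ℕ 5) →
  e 0 % 5 ≢ 2 → e 1 % 5 ≢ 2 → e 2 % 5 ≢ 2 → e 3 % 5 ≢ 2 → e 4 % 5 ≢ 2 → ∀ n → e n % 5 ≢ 2
shift-by-5 e k h h₀ h₁ h₂ h₃ h₄ = go
  where
  go : ∀ n → e n % 5 ≢ 2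
  go 0 = h₀
  go 1 = h₁
  go 2 = h₂
  go 3 = h₃
  go 4 = h₄
  go (suc (suc (suc (suc (suc n))))) eq = go n
      (≡.trans (≡.sym ([m+kn]%n≡m%n (e n) (k n) 5)) (≡.trans (cong (_% 5) (≡.sym (h n))) eq))

open import Data.Nat using (_+_; _*_)

theorem2 : (n : ℕ) → 2 ∣ c₂ (5 * n + 2)
theorem2 n = GeneratingFunction.c₂-even (5 * n + 2)
  (λ eq → ℕₚ.1+n≢0 (≡.trans (ℕₚ.+-comm 2 (5 *ℕ n)) eq))
  -- Here (θ(n+5) - θ(n)) / 5 = (40n + 95) / 5 = 8n + 19. The five nested `step`s unfold the
  -- recursion of `θ`, with `t` standing for θ(n).
  (avoids (shift-by-5 θ (λ n → 8 *ℕ n +ℕ 19) (λ n → solve 2 (λ t n →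
      let step = λ t n → t :+ (((n :+ n) :+ (n :+ n)) :+ ((n :+ n) :+ (n :+ n))) :+ con 3 in
      step (step (step (step (step t n) (con 1 :+ n)) (con 2 :+ n)) (con 3 :+ n)) (con 4 :+ n)
      := t :+ (con 8 :* n :+ con 19) :* con 5) ≡.refl (θ n) n)
    (λ ()) (λ ()) (λ ()) (λ ()) (λ ())))
  (avoids (shift-by-5 (λ n → θ n +ℕ (n +ℕ n)) (λ n → 8 *ℕ n +ℕ 21) (λ n → solve 2 (λ t n →
      let step = λ t n → t :+ (((n :+ n) :+ (n :+ n)) :+ ((n :+ n) :+ (n :+ n))) :+ con 3 in
      step (step (step (step (step t n) (con 1 :+ n)) (con 2 :+ n)) (con 3 :+ n)) (con 4 :+ n) :+
          ((con 5 :+ n) :+ (con 5 :+ n))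
      := t :+ (n :+ n) :+ (con 8 :* n :+ con 21) :* con 5) ≡.refl (θ n) n)
    (λ ()) (λ ()) (λ ()) (λ ()) (λ ())))
  (avoids (shift-by-5 τ (λ n → 4 *ℕ n +ℕ 11) (λ n → solve 1 (λ n →
      (con 5 :+ n) :+ ((con 5 :+ n) :* (con 5 :+ n) :+ (con 5 :+ n) :* (con 5 :+ n))
           := n :+ (n :* n :+ n :* n) :+ (con 4 :* n :+ con 11) :* con 5) ≡.refl n)
    (λ ()) (λ ()) (λ ()) (λ ()) (λ ())))
  (avoids (shift-by-5 (λ n → τ n +ℕ suc (n +ℕ n)) (λ n → 4 *ℕ n +ℕ 13) (λ n → solve 1 (λ n →
      (con 5 :+ n) :+ ((con 5 :+ n) :* (con 5 :+ n) :+ (con 5 :+ n) :* (con 5 :+ n)) :+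
          (con 1 :+ ((con 5 :+ n) :+ (con 5 :+ n)))
      := n :+ (n :* n :+ n :* n) :+ (con 1 :+ (n :+ n)) :+ (con 4 :* n :+ con 13) :* con 5) ≡.refl n)
    (λ ()) (λ ()) (λ ()) (λ ()) (λ ())))
  where
  open +-*-Solver
  avoids : ∀ {e : ℕ → ℕ} → (∀ m → e m % 5 ≢ 2) → ∀ m → 5 *ℕ n +ℕ 2 ≢ e m
  avoids h m eq = h m (≡.trans (cong (_% 5)
      (≡.trans (≡.sym eq) (≡.trans (ℕₚ.+-comm (5 *ℕ n) 2) (cong (2 +ℕ_) (ℕₚ.*-comm 5 n)))))
      ([m+kn]%n≡m%n 2 n 5))
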